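{- Let $(A_n,B_n)_{n\ge2}$ be the twin Seidel matrix sequence, $A_n=(a_n(m,k))$. Then, as formal power series in $x,y,z$, $$\sum a_{2n}(m,k)\frac{x^{m-1}}{(m-1)!}\frac{y^{k-m-1}}{(k-m-1)!}\frac{z^{2n-k-1}}{(2n-k-1)!}=\frac{\cos x\,\cos z\,\sin(x+y+z)}{\cos^2(x+y+z)},$$ the sum being over all integers $n\ge1$, $m,k$ with $2\le m+1\le k\le 2n-1$, and $$\sum a_{2n}(m,k)\frac{x^{2n-m-1}}{(2n-m-1)!}\frac{y^{m-k-1}}{(m-k-1)!}\frac{z^{k-1}}{(k-1)!}=\frac{\cos x\,\sin z}{\cos(x+y+z)}+\frac{\sin x\,\cos(x+y)}{\cos^2(x+y+z)},$$ the sum being over all integers $n\ge1$, $m,k$ with $2\le k+1\le m\le 2n-1$.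
   Context: Twin Seidel matrix sequence: the unique sequence of square matrices $A_n=(a_n(m,k))_{1\le m,k\le n}$, $B_n=(b_n(m,k))_{1\le m,k\le n}$ ($n\ge2$) with nonnegative integer entries satisfying, with $a_n(m,\bullet)=\sum_k a_n(m,k)$, $a_n(\bullet,k)=\sum_m a_n(m,k)$ and similarly for $b$: (TS1) all diagonal entries are $0$, except $a_2(1,1)=1$; (TS2) for $n\ge3$: $a_n(m,n)=b_n(m,n)=0$ for all $m$, $a_n(n,k)=b_n(1,k)=0$ for all $k$, and $b_n(n,1)=0$; (TS3) $A_2=\begin{pmatrix}1&0\\0&0\end{pmatrix}$, $B_2=\begin{pmatrix}0&0\\1&0\end{pmatrix}$; (TS4) for $n\ge3$: $b_n(n,k)=a_{n-1}(\bullet,k-1)$ for $2\le k\le n-1$; $b_n(n-1,k)=a_{n-1}(\bullet,k)$ for $1\le k\le n-2$; $b_n(m+1,k)-b_n(m,k)=a_{n-1}(m,k)$ for $2\le k+1\le m\le n-2$; $b_n(m+1,k)-b_n(m,k)=a_{n-1}(m,k-1)$ for $3\le m+2\le k\le n-1$; (TS5) for $n\ge3$: $a_n(1,k)=b_{n-1}(\bullet,k-1)$ for $2\le k\le n-1$; $a_n(m+1,k)-a_n(m,k)=-b_{n-1}(m,k-1)$ for $3\le m+2\le k\le n-1$; $a_n(m+1,k)-a_n(m,k)=-b_{n-1}(m,k)$ for $2\le k+1\le m\le n-1$. -}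

module Defs where

open import Data.Nat as ℕ using (ℕ; zero; suc; _!; _≤_; _<_)
open import Data.Nat.Properties using (_!≢0)
open import Data.Integer using (+_)
open import Data.Rational using (ℚ; 0ℚ; 1ℚ; _+_; _*_; -_; _/_)
open import Data.Bool using (Bool; true; false; if_then_else_)
open import Relation.Binary.PropositionalEquality using (_≡_)

-- Twin Seidel matrix sequences.
-- A matrix family is  M : ℕ → ℕ → ℕ → ℕ  with  M n m k = a_n(m,k);
-- only the entries with 1 ≤ m,k ≤ n are meaningful.

Fam : Set
Fam = ℕ → ℕ → ℕ → ℕ

Σ₁ : ℕ → (ℕ → ℕ) → ℕ
Σ₁ zero    f = 0
Σ₁ (suc n) f = Σ₁ n f ℕ.+ f (suc n)

rowSum : Fam → ℕ → ℕ → ℕ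
rowSum M n m = Σ₁ n (λ k → M n m k)

colSum : Fam → ℕ → ℕ → ℕ
colSum M n k = Σ₁ n (λ m → M n m k)

-- (TS1)-(TS5); differences of nonnegative integers are written additively.
record IsTwinSeidel (a b : Fam) : Set where
  field
    -- (TS1)
    -- (for n = 2 the diagonal is fixed by (TS3), including a_2(1,1) = 1)
    ts1a : ∀ n m → 3 ≤ n → 1 ≤ m → m ≤ n → a n m m ≡ 0
    ts1b : ∀ n m → 3 ≤ n → 1 ≤ m → m ≤ n → b n m m ≡ 0
    ts2aCol : ∀ n m → 3 ≤ n → 1 ≤ m → m ≤ n → a n m n ≡ 0
    ts2bCol : ∀ n m → 3 ≤ n → 1 ≤ m → m ≤ n → b n m n ≡ 0
    ts2aRow : ∀ n k → 3 ≤ n → 1 ≤ k → k ≤ n → a n n k ≡ 0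
    ts2bRow : ∀ n k → 3 ≤ n → 1 ≤ k → k ≤ n → b n 1 k ≡ 0
    ts2bCorner : ∀ n → 3 ≤ n → b n n 1 ≡ 0
    ts3a11 : a 2 1 1 ≡ 1
    ts3a21 : a 2 2 1 ≡ 0
    ts3a12 : a 2 1 2 ≡ 0
    ts3a22 : a 2 2 2 ≡ 0
    ts3b11 : b 2 1 1 ≡ 0
    ts3b12 : b 2 1 2 ≡ 0
    ts3b21 : b 2 2 1 ≡ 1
    ts3b22 : b 2 2 2 ≡ 0
    ts4a : ∀ n k → 3 ≤ n → 2 ≤ k → k ≤ n ℕ.∸ 1 →
           b n n k ≡ colSum a (n ℕ.∸ 1) (k ℕ.∸ 1)
    ts4b : ∀ n k → 3 ≤ n → 1 ≤ k → k ≤ n ℕ.∸ 2 →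
           b n (n ℕ.∸ 1) k ≡ colSum a (n ℕ.∸ 1) k
    ts4c : ∀ n m k → 3 ≤ n → 2 ≤ k ℕ.+ 1 → k ℕ.+ 1 ≤ m → m ≤ n ℕ.∸ 2 →
           b n (suc m) k ≡ b n m k ℕ.+ a (n ℕ.∸ 1) m k
    ts4d : ∀ n m k → 3 ≤ n → 3 ≤ m ℕ.+ 2 → m ℕ.+ 2 ≤ k → k ≤ n ℕ.∸ 1 →
           b n (suc m) k ≡ b n m k ℕ.+ a (n ℕ.∸ 1) m (k ℕ.∸ 1)
    ts5a : ∀ n k → 3 ≤ n → 2 ≤ k → k ≤ n ℕ.∸ 1 →
           a n 1 k ≡ colSum b (n ℕ.∸ 1) (k ℕ.∸ 1)
    ts5b : ∀ n m k → 3 ≤ n → 3 ≤ m ℕ.+ 2 → m ℕ.+ 2 ≤ k → k ≤ n ℕ.∸ 1 →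
           a n m k ≡ a n (suc m) k ℕ.+ b (n ℕ.∸ 1) m (k ℕ.∸ 1)
    ts5c : ∀ n m k → 3 ≤ n → 2 ≤ k ℕ.+ 1 → k ℕ.+ 1 ≤ m → m ≤ n ℕ.∸ 1 →
           a n m k ≡ a n (suc m) k ℕ.+ b (n ℕ.∸ 1) m k

-- Formal power series over ℚ.
-- Univariate series: ℕ → ℚ (coefficient of t^N).
-- Series in x,y,z: PS3 i j l = coefficient of x^i y^j z^l.

PS1 : Set
PS1 = ℕ → ℚ

PS3 : Set
PS3 = ℕ → ℕ → ℕ → ℚ

ℕ→ℚ : ℕ → ℚ
ℕ→ℚ n = (+ n) / 1

inv! : ℕ → ℚ
inv! n = (+ 1) / (n !)
  where instance _ = n !≢0

even : ℕ → Bool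
even zero          = true
even (suc zero)    = false
even (suc (suc n)) = even n

half : ℕ → ℕ
half zero          = zero
half (suc zero)    = zero
half (suc (suc n)) = suc (half n)

sgn : ℕ → ℚ
sgn zero    = 1ℚ
sgn (suc n) = - sgn n

cosS : PS1
cosS N = if even N then sgn (half N) * inv! N else 0ℚ

sinS : PS1
sinS N = if even N then 0ℚ else sgn (half N) * inv! N

isZero : ℕ → Bool
isZero zero    = true
isZero (suc _) = false

-- substitutions f(x), f(z), f(x+y), f(x+y+z) of a univariate series
-- (t^N with t = x+y+z expands to Σ N!/(i! j! l!) x^i y^j z^l)
inX : PS1 → PS3
inX f i j l = if isZero j then (if isZero l then f i else 0ℚ) else 0ℚ

inZ : PS1 → PS3
inZ f i j l = if isZero i then (if isZero j then f l else 0ℚ) else 0ℚ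

inXY : PS1 → PS3
inXY f i j l = if isZero l
  then f (i ℕ.+ j) * ((ℕ→ℚ ((i ℕ.+ j) !)) * (inv! i * inv! j))
  else 0ℚ

inXYZ : PS1 → PS3
inXYZ f i j l =
  f (i ℕ.+ j ℕ.+ l) * ((ℕ→ℚ ((i ℕ.+ j ℕ.+ l) !)) * (inv! i * (inv! j * inv! l)))

Σ₀ : ℕ → (ℕ → ℚ) → ℚ
Σ₀ zero    f = f 0
Σ₀ (suc n) f = Σ₀ n f + f (suc n)

_⊕_ : PS3 → PS3 → PS3
(f ⊕ g) i j l = f i j l + g i j l

_⊛_ : PS3 → PS3 → PS3
(f ⊛ g) i j l =
  Σ₀ i λ a → Σ₀ j λ b → Σ₀ l λ c →
    f a b c * g (i ℕ.∸ a) (j ℕ.∸ b) (l ℕ.∸ c)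

infixl 6 _⊕_
infixl 7 _⊛_

-- The two generating functions of the theorem.
-- Coefficient of x^i y^j z^l in
--   Σ a_{2n}(m,k) x^(m-1)/(m-1)! y^(k-m-1)/(k-m-1)! z^(2n-k-1)/(2n-k-1)!
-- (2 ≤ m+1 ≤ k ≤ 2n-1): the unique term has m = i+1, k = i+j+2,
-- 2n = i+j+l+3, present iff i+j+l+3 is even.
genUpper : Fam → PS3
genUpper a i j l =
  if even (i ℕ.+ j ℕ.+ l ℕ.+ 3)
  then ℕ→ℚ (a (i ℕ.+ j ℕ.+ l ℕ.+ 3) (i ℕ.+ 1) (i ℕ.+ j ℕ.+ 2))
         * (inv! i * (inv! j * inv! l))
  else 0ℚ

-- Coefficient of x^i y^j z^l in
--   Σ a_{2n}(m,k) x^(2n-m-1)/(2n-m-1)! y^(m-k-1)/(m-k-1)! z^(k-1)/(k-1)!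
-- (2 ≤ k+1 ≤ m ≤ 2n-1): the unique term has k = l+1, m = l+j+2,
-- 2n = i+j+l+3, present iff i+j+l+3 is even.
genLower : Fam → PS3
genLower a i j l =
  if even (i ℕ.+ j ℕ.+ l ℕ.+ 3)
  then ℕ→ℚ (a (i ℕ.+ j ℕ.+ l ℕ.+ 3) (l ℕ.+ j ℕ.+ 2) (l ℕ.+ 1))
         * (inv! i * (inv! j * inv! l))
  else 0ℚ

{-# OPTIONS --safe #-}
module Submission where

open import Defs
open import Algebra using (CommutativeRing)
import Level
import Algebra.Construct.Pointwise as Pointwise
import Algebra.Properties.Ring as RingProperties
import Algebra.Properties.Semiring.Mult as SemiringMult
import Algebra.Properties.CommutativeSemigroup as CommutativeSemigroupProperties
import Algebra.Solver.Ring.NaturalCoefficients.Default as SemiringSolver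
open import Data.Bool using (Bool; true; false; if_then_else_; not)
open import Data.Integer as ℤ using (1ℤ)
import Data.Integer.Properties as ℤₚ
open import Data.Nat as ℕ using (ℕ; zero; suc; _!; _≤_; z≤n; s≤s)
open import Data.Nat.Properties as ℕₚ using (m≤n⇒m≤1+n; _!≢0)
open import Data.Product using (_×_; _,_)
open import Relation.Binary.PropositionalEquality as ≡ using (_≡_)
import Relation.Binary.Reasoning.Setoid as SetoidReasoning

-- Index the upper and lower entries of A_n and B_n by the exponents of x, y, z.
-- Both column sums in (TS4) and (TS5) telescope, so the recurrences become:
-- ∂x - ∂y (resp. ∂z - ∂y) rotates the pair of generating functions of A and B,
-- and their restrictions to x = 0, y = 0, z = 0 are linked linearly. These
-- relations determine all coefficients by induction on n, so it suffices that
-- the closed forms, written with sec(x+y+z), satisfy them; this follows from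
-- the addition theorems.

-- In exponential coordinates the matrix entries are themselves the coefficients, a partial
-- derivative is an index shift, and a series is its value at 0 followed by its derivative.
-- Identities follow from equal derivatives and equal restrictions without dividing by integers, so
-- the recurrences are solved over any commutative ring; ℚ enters only with the matrices and the
-- ordinary coefficients of the theorem. The rotation forces the shape of the closed forms: BU = L
-- cos x + M sin x and AU = M cos x - L sin x, where `∂x - ∂y` kills L and M, so that they can be
-- read off at x = 0. The lower pair has the same shape with z in place of x. Restricting to one
-- parity is essential: `a_3(2,1) = 1`, so the border condition that the lower entries of A vanish
-- at x = z = 0 fails for odd n. The theorem multiplies series by convolution over ℚ. Scaling
-- coefficients by i! j! l! leads to the product used here; the two products are compared through
-- their Leibniz rules rather than through binomial coefficients.

-- The ring of Hurwitz series.

-- Exponential generating functions Σ f(n) tⁿ/n! over R, represented by f.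
-- The product is defined by the Leibniz rule instead of binomial convolution.
module Hurwitz {c ℓ} (R : CommutativeRing c ℓ) where
  open CommutativeRing R
  open CommutativeSemigroupProperties +-commutativeSemigroup using (interchange)
  open SetoidReasoning setoid

  Series : Set c
  Series = ℕ → Carrier

  infix 4 _≋_
  infixl 6 _⊞_
  infixl 7 _⊠_

  _≋_ : Series → Series → Set ℓ
  f ≋ g = ∀ n → f n ≈ g n

  _⊞_ : Series → Series → Series
  (f ⊞ g) n = f n + g n

  𝟙 : Series
  𝟙 zero    = 1#
  𝟙 (suc n) = 0#

  D : Series → Series
  D f n = f (suc n)

  _⊠_ : Series → Series → Series
  (f ⊠ g) zero    = f 0 * g 0
  (f ⊠ g) (suc n) = (D f ⊠ g) n + (f ⊠ D g) n

  ⊠-cong : ∀ {f f′ g g′} → f ≋ f′ → g ≋ g′ → f ⊠ g ≋ f′ ⊠ g′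
  ⊠-cong p q zero    = *-cong (p 0) (q 0)
  ⊠-cong p q (suc n) =
    +-cong (⊠-cong (λ k → p (suc k)) q n) (⊠-cong p (λ k → q (suc k)) n)

  ⊠-comm : ∀ f g → f ⊠ g ≋ g ⊠ f
  ⊠-comm f g zero    = *-comm (f 0) (g 0)
  ⊠-comm f g (suc n) =
    trans (+-cong (⊠-comm (D f) g n) (⊠-comm f (D g) n)) (+-comm _ _)

  ⊠-distribʳ-⊞ : ∀ h f g → (f ⊞ g) ⊠ h ≋ f ⊠ h ⊞ g ⊠ h
  ⊠-distribʳ-⊞ h f g zero    = distribʳ (h 0) (f 0) (g 0)
  ⊠-distribʳ-⊞ h f g (suc n) =
    trans (+-cong (⊠-distribʳ-⊞ h (D f) (D g) n) (⊠-distribʳ-⊞ (D h) f g n))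
          (interchange _ _ _ _)

  ⊠-distribˡ-⊞ : ∀ h f g → h ⊠ (f ⊞ g) ≋ h ⊠ f ⊞ h ⊠ g
  ⊠-distribˡ-⊞ h f g n = begin
    (h ⊠ (f ⊞ g)) n            ≈⟨ ⊠-comm h (f ⊞ g) n ⟩
    ((f ⊞ g) ⊠ h) n            ≈⟨ ⊠-distribʳ-⊞ h f g n ⟩
    (f ⊠ h) n + (g ⊠ h) n      ≈⟨ +-cong (⊠-comm f h n) (⊠-comm g h n) ⟩
    (h ⊠ f) n + (h ⊠ g) n      ∎

  ⊠-assoc : ∀ f g h → (f ⊠ g) ⊠ h ≋ f ⊠ (g ⊠ h)
  ⊠-assoc f g h zero    = *-assoc (f 0) (g 0) (h 0)
  ⊠-assoc f g h (suc n) = begin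
    ((D f ⊠ g ⊞ f ⊠ D g) ⊠ h) n + ((f ⊠ g) ⊠ D h) n
      ≈⟨ +-congʳ (⊠-distribʳ-⊞ h (D f ⊠ g) (f ⊠ D g) n) ⟩
    (((D f ⊠ g) ⊠ h) n + ((f ⊠ D g) ⊠ h) n) + ((f ⊠ g) ⊠ D h) n
      ≈⟨ +-assoc _ _ _ ⟩
    ((D f ⊠ g) ⊠ h) n + (((f ⊠ D g) ⊠ h) n + ((f ⊠ g) ⊠ D h) n)
      ≈⟨ +-cong (⊠-assoc (D f) g h n)
                (+-cong (⊠-assoc f (D g) h n) (⊠-assoc f g (D h) n)) ⟩
    (D f ⊠ (g ⊠ h)) n + ((f ⊠ (D g ⊠ h)) n + (f ⊠ (g ⊠ D h)) n)
      ≈⟨ +-congˡ (sym (⊠-distribˡ-⊞ f (D g ⊠ h) (g ⊠ D h) n)) ⟩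
    (D f ⊠ (g ⊠ h)) n + (f ⊠ (D g ⊠ h ⊞ g ⊠ D h)) n ∎

  ⊠-zeroˡ : ∀ f → (λ _ → 0#) ⊠ f ≋ (λ _ → 0#)
  ⊠-zeroˡ f zero    = zeroˡ (f 0)
  ⊠-zeroˡ f (suc n) =
    trans (+-cong (⊠-zeroˡ f n) (⊠-zeroˡ (D f) n)) (+-identityˡ 0#)

  ⊠-identityˡ : ∀ f → 𝟙 ⊠ f ≋ f
  ⊠-identityˡ f zero    = *-identityˡ (f 0)
  ⊠-identityˡ f (suc n) =
    trans (+-cong (⊠-zeroˡ f n) (⊠-identityˡ (D f) n)) (+-identityˡ _)

  hurwitzRing : CommutativeRing c ℓ
  hurwitzRing = record
    { Carrier = Series
    ; _≈_ = _≋_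
    ; _+_ = _⊞_
    ; _*_ = _⊠_
    ; -_ = λ f n → - f n
    ; 0# = λ _ → 0#
    ; 1# = 𝟙
    ; isCommutativeRing = record
      { isRing = record
        { +-isAbelianGroup = Pointwise.isAbelianGroup ℕ +-isAbelianGroup
        ; *-cong = ⊠-cong
        ; *-assoc = ⊠-assoc
        ; *-identity = ⊠-identityˡ ,
            λ f n → trans (⊠-comm f 𝟙 n) (⊠-identityˡ f n)
        ; distrib = ⊠-distribˡ-⊞ , ⊠-distribʳ-⊞
        }
      ; *-comm = ⊠-comm
      }
    }

-- Derivations, rotations and difference formulas.

record IsDerivation {c ℓ} (R : CommutativeRing c ℓ)
                    (d : CommutativeRing.Carrier R → CommutativeRing.Carrier R)
                    : Set (c Level.⊔ ℓ) where
  open CommutativeRing R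
  field
    d-cong  : ∀ {x y} → x ≈ y → d x ≈ d y
    d-+     : ∀ x y → d (x + y) ≈ d x + d y
    leibniz : ∀ x y → d (x * y) ≈ d x * y + x * d y

  open RingProperties ring using (x+x≈x⇒x≈0; +-inverseˡ-unique)

  d-0 : d 0# ≈ 0#
  d-0 = x+x≈x⇒x≈0 (d 0#) (trans (sym (d-+ 0# 0#)) (d-cong (+-identityˡ 0#)))

  d-‿ : ∀ x → d (- x) ≈ - d x
  d-‿ x = +-inverseˡ-unique (d (- x)) (d x)
    (trans (sym (d-+ (- x) x)) (trans (d-cong (-‿inverseˡ x)) d-0))

  d-− : ∀ x y → d (x + - y) ≈ d x + - d y
  d-− x y = trans (d-+ x (- y)) (+-congˡ (d-‿ y))

module _ {c ℓ} (R : CommutativeRing c ℓ) where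
  open CommutativeRing R
  open CommutativeSemigroupProperties +-commutativeSemigroup using (interchange)
  open Hurwitz R

  D-isDerivation : IsDerivation hurwitzRing D
  D-isDerivation = record
    { d-cong  = λ p n → p (suc n)
    ; d-+     = λ f g n → refl
    ; leibniz = λ f g n → refl
    }

  -- Carries a derivation in an inner variable past an outer one: one lift yields `∂y`, two lifts
  -- yield `∂z`.
  coefficientwise-isDerivation : ∀ {d} → IsDerivation R d →
    IsDerivation hurwitzRing (λ f n → d (f n))
  coefficientwise-isDerivation {d} der = record
    { d-cong  = λ p n → d-cong (p n)
    ; d-+     = λ f g n → d-+ (f n) (g n)
    ; leibniz = leib
    }
    where
    open IsDerivation der
    leib : ∀ f g n → d ((f ⊠ g) n) ≈
      ((λ k → d (f k)) ⊠ g) n + (f ⊠ (λ k → d (g k))) n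
    leib f g zero    = leibniz (f 0) (g 0)
    leib f g (suc n) =
      trans (d-+ _ _) (trans (+-cong (leib (D f) g n) (leib f (D g) n))
                             (interchange _ _ _ _))

module Derivations {c ℓ} (R : CommutativeRing c ℓ)
                   {d e : CommutativeRing.Carrier R → CommutativeRing.Carrier R}
                   (d-der : IsDerivation R d) (e-der : IsDerivation R e) where
  open CommutativeRing R
  open RingProperties (CommutativeRing.ring R)
  open SetoidReasoning setoid
  open SemiringSolver commutativeSemiring
  open IsDerivation d-der
  open IsDerivation e-der using ()
    renaming (d-cong to e-cong; d-+ to e-+; leibniz to e-leibniz; d-− to e-−)

  -- Shows factor by factor that `d - e` kills a product. For ∂x and ∂y the factors involve x and y
  -- only through x + y; for ∂z and ∂y they involve y and z only through y + z.
  agree-* : ∀ {x y} → d x ≈ e x → d y ≈ e y → d (x * y) ≈ e (x * y)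
  agree-* {x} {y} p q = begin
    d (x * y)          ≈⟨ leibniz x y ⟩
    d x * y + x * d y  ≈⟨ +-cong (*-congʳ p) (*-congˡ q) ⟩
    e x * y + x * e y  ≈⟨ sym (e-leibniz x y) ⟩
    e (x * y)          ∎

  -- d acts on c and s as on cosine and sine, e treats them as constants, and
  -- d - e kills L and M; so d - e rotates the pair (c L + s M , c M - s L).
  module Rotation {c s L M : Carrier}
                  (dc : d c ≈ - s) (ds : d s ≈ c) (ec : e c ≈ 0#) (es : e s ≈ 0#)
                  (dL : d L ≈ e L) (dM : d M ≈ e M) where

    private
      e-constant : ∀ {x} y → e x ≈ 0# → e (x * y) ≈ x * e y
      e-constant {x} y p = begin
        e (x * y)          ≈⟨ e-leibniz x y ⟩
        e x * y + x * e y  ≈⟨ +-congʳ (trans (*-congʳ p) (zeroˡ y)) ⟩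
        0# + x * e y       ≈⟨ +-identityˡ _ ⟩
        x * e y            ∎

    rotation₁ : d (c * L + s * M) ≈ e (c * L + s * M) + (c * M + - (s * L))
    rotation₁ = begin
      d (c * L + s * M)
        ≈⟨ trans (d-+ _ _) (+-cong (leibniz c L) (leibniz s M)) ⟩
      (d c * L + c * d L) + (d s * M + s * d M)
        ≈⟨ +-cong (+-cong (trans (*-congʳ dc) (sym (-‿distribˡ-* s L))) (*-congˡ dL))
                  (+-cong (*-congʳ ds) (*-congˡ dM)) ⟩
      (- (s * L) + c * e L) + (c * M + s * e M)
        ≈⟨ solve 4 (λ p q r t → (p :+ q) :+ (r :+ t) := (q :+ t) :+ (r :+ p)) refl
             (- (s * L)) (c * e L) (c * M) (s * e M) ⟩
      (c * e L + s * e M) + (c * M + - (s * L))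
        ≈⟨ +-congʳ (sym (trans (e-+ _ _) (+-cong (e-constant L ec) (e-constant M es)))) ⟩
      e (c * L + s * M) + (c * M + - (s * L)) ∎

    -- The minus sign of the second rotation equation is absorbed by exchanging the sides of `d` and
    -- `e`; both equations then have the form of the additive recurrences for A and B.
    rotation₂ : e (c * M + - (s * L)) ≈ d (c * M + - (s * L)) + (c * L + s * M)
    rotation₂ = begin
      e (c * M + - (s * L))
        ≈⟨ e-− (c * M) (s * L) ⟩
      e (c * M) + - e (s * L)
        ≈⟨ +-cong (e-constant M ec) (-‿cong (e-constant L es)) ⟩
      c * e M + - (s * e L)
        ≈⟨ +-cong (*-congˡ (sym dM)) (-‿cong (*-congˡ (sym dL))) ⟩
      c * d M + - (s * d L)
        -- The inserted zeros supply `- (s * M)` and `- (c * L)`, which are the terms `d c * M` and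
        -- `- (d s * L)` of the Leibniz rule; their opposites form the added summand.
        ≈⟨ sym (trans (+-cong (-‿inverseˡ (s * M)) (+-congʳ (-‿inverseˡ (c * L))))
                      (trans (+-identityˡ _) (+-identityˡ _))) ⟩
      (- (s * M) + s * M) + ((- (c * L) + c * L) + (c * d M + - (s * d L)))
        ≈⟨ solve 6 (λ p q r t u v →
               (p :+ q) :+ ((r :+ t) :+ (u :+ v)) := ((p :+ u) :+ (r :+ v)) :+ (t :+ q)) refl
             (- (s * M)) (s * M) (- (c * L)) (c * L) (c * d M) (- (s * d L)) ⟩
      ((- (s * M) + c * d M) + (- (c * L) + - (s * d L))) + (c * L + s * M)
        ≈⟨ +-congʳ (+-cong (+-congʳ (trans (-‿distribˡ-* s M) (*-congʳ (sym dc))))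
                           (trans (-‿+-comm _ _) (-‿cong (+-congʳ (*-congʳ (sym ds)))))) ⟩
      ((d c * M + c * d M) + - (d s * L + s * d L)) + (c * L + s * M)
        ≈⟨ +-congʳ (sym (trans (d-− _ _) (+-cong (leibniz c M) (-‿cong (leibniz s L))))) ⟩
      d (c * M + - (s * L)) + (c * L + s * M) ∎

module CircularPairs {c ℓ} (R : CommutativeRing c ℓ)
                     {d : CommutativeRing.Carrier R → CommutativeRing.Carrier R}
                     (d-der : IsDerivation R d) where
  open CommutativeRing R
  open RingProperties (CommutativeRing.ring R)
  open SetoidReasoning setoid
  open IsDerivation d-der

  module _ {c s C S : Carrier}
           (dc : d c ≈ - s) (ds : d s ≈ c) (dC : d C ≈ - S) (dS : d S ≈ C) where

    -- If c, s are cos t, sin t and C, S are cos (t + u), sin (t + u), the element is cos u, which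
    -- does not depend on t. The case u = 0 is Pythagoras.
    cos-difference : d (c * C + s * S) ≈ 0#
    cos-difference = begin
      d (c * C + s * S)
        ≈⟨ trans (d-+ _ _) (+-cong (leibniz c C) (leibniz s S)) ⟩
      (d c * C + c * d C) + (d s * S + s * d S)
        ≈⟨ +-cong (+-cong (trans (*-congʳ dc) (sym (-‿distribˡ-* s C)))
                          (trans (*-congˡ dC) (sym (-‿distribʳ-* c S))))
                  (+-cong (*-congʳ ds) (*-congˡ dS)) ⟩
      (- (s * C) + - (c * S)) + (c * S + s * C)
        ≈⟨ trans (+-congʳ (-‿+-comm _ _)) (+-congˡ (+-comm _ _)) ⟩
      - (s * C + c * S) + (s * C + c * S)
        ≈⟨ -‿inverseˡ _ ⟩
      0# ∎

    sin-difference : d (c * S + - (s * C)) ≈ 0#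
    sin-difference = begin
      d (c * S + - (s * C))
        ≈⟨ trans (d-− _ _) (+-cong (leibniz c S) (-‿cong (leibniz s C))) ⟩
      (d c * S + c * d S) + - (d s * C + s * d C)
        ≈⟨ +-cong (+-cong (trans (*-congʳ dc) (sym (-‿distribˡ-* s S))) (*-congˡ dS))
                  (-‿cong (+-cong (*-congʳ ds)
                                  (trans (*-congˡ dC) (sym (-‿distribʳ-* s S))))) ⟩
      (- (s * S) + c * C) + - (c * C + - (s * S))
        ≈⟨ trans (+-congʳ (+-comm _ _)) (-‿inverseʳ _) ⟩
      0# ∎

-- Cosine, sine, secant and powers of the tangent.

module Trigonometric {c ℓ} (R : CommutativeRing c ℓ) where
  open CommutativeRing R
  open RingProperties (CommutativeRing.ring R)
  open SemiringMult semiring renaming (_×_ to _·_)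
  open SemiringSolver commutativeSemiring
  open Hurwitz R
  private module H = CommutativeRing hurwitzRing

  cosE sinE : Series
  cosE zero    = 1#
  cosE (suc n) = - sinE n
  sinE zero    = 0#
  sinE (suc n) = cosE n

  -- tan^ q and sec·tan^ q are defined by the differential equations
  --   (tan^q)′ = q (tan^(q-1) + tan^(q+1)),
  --   (sec tan^q)′ = (q+1) sec tan^(q+1) + q sec tan^(q-1),
  -- whose right-hand sides make the recursion structural.
  0^ : ℕ → Carrier
  0^ zero    = 1#
  0^ (suc q) = 0#

  tan^ sec·tan^ : ℕ → Series
  tan^ q zero    = 0^ q
  tan^ q (suc n) = q · tan^ (suc q) n + q · tan^ (ℕ.pred q) n
  sec·tan^ q zero    = 0^ q
  sec·tan^ q (suc n) = suc q · sec·tan^ (suc q) n + q · sec·tan^ (ℕ.pred q) n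

  ⊠-·ʳ : ∀ m f g n → (f ⊠ (λ k → m · g k)) n ≈ m · (f ⊠ g) n
  ⊠-·ʳ zero    f g n = H.zeroʳ f n
  ⊠-·ʳ (suc m) f g n =
    trans (⊠-distribˡ-⊞ f g (λ k → m · g k) n) (+-congˡ (⊠-·ʳ m f g n))

  private
    ⊠-·-·ʳ : ∀ k m f g h n →
      (f ⊠ (λ j → k · g j + m · h j)) n ≈ k · (f ⊠ g) n + m · (f ⊠ h) n
    ⊠-·-·ʳ k m f g h n = trans
      (⊠-distribˡ-⊞ f (λ j → k · g j) (λ j → m · h j) n)
      (+-cong (⊠-·ʳ k f g n) (⊠-·ʳ m f h n))

  -- Proved together with the sine version by induction on n for all q at once, because
  -- differentiating exchanges cosine and sine and moves q to q + 1 and q - 1.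
  cos⊠sec·tan^ : ∀ n q → (cosE ⊠ sec·tan^ q) n ≈ tan^ q n
  sin⊠sec·tan^ : ∀ n q → (sinE ⊠ sec·tan^ q) n ≈ tan^ (suc q) n

  cos⊠sec·tan^ zero    q = *-identityˡ (0^ q)
  cos⊠sec·tan^ (suc n) q = begin
    ((λ k → - sinE k) ⊠ sec·tan^ q) n + (cosE ⊠ D (sec·tan^ q)) n
      ≈⟨ +-cong
           (sym (RingProperties.-‿distribˡ-* H.ring sinE (sec·tan^ q) n))
           (⊠-·-·ʳ (suc q) q cosE (sec·tan^ (suc q)) (sec·tan^ (ℕ.pred q)) n) ⟩
    - (sinE ⊠ sec·tan^ q) n +
      (suc q · (cosE ⊠ sec·tan^ (suc q)) n + q · (cosE ⊠ sec·tan^ (ℕ.pred q)) n)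
      ≈⟨ +-cong (-‿cong (sin⊠sec·tan^ n q))
           (+-cong (×-congʳ (suc q) (cos⊠sec·tan^ n (suc q)))
                   (×-congʳ q (cos⊠sec·tan^ n (ℕ.pred q)))) ⟩
    - t + ((t + q · t) + q · tan^ (ℕ.pred q) n)
      -- The derivative of the cosine contributes `- t`, which cancels one of the q + 1 copies of
      -- `t`; the remaining q copies belong to the derivative of tan^q.
      ≈⟨ solve 4 (λ x y z w → x :+ ((y :+ z) :+ w) := (x :+ y) :+ (z :+ w)) refl
           (- t) t (q · t) (q · tan^ (ℕ.pred q) n) ⟩
    (- t + t) + (q · t + q · tan^ (ℕ.pred q) n)
      ≈⟨ trans (+-congʳ (-‿inverseˡ t)) (+-identityˡ _) ⟩
    q · t + q · tan^ (ℕ.pred q) n ∎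
    where
    open SetoidReasoning setoid
    t = tan^ (suc q) n

  sin⊠sec·tan^ zero    q = zeroˡ (0^ q)
  sin⊠sec·tan^ (suc n) q = begin
    (cosE ⊠ sec·tan^ q) n + (sinE ⊠ D (sec·tan^ q)) n
      ≈⟨ +-congˡ (⊠-·-·ʳ (suc q) q sinE (sec·tan^ (suc q)) (sec·tan^ (ℕ.pred q)) n) ⟩
    (cosE ⊠ sec·tan^ q) n +
      (suc q · (sinE ⊠ sec·tan^ (suc q)) n + q · (sinE ⊠ sec·tan^ (ℕ.pred q)) n)
      ≈⟨ +-cong (cos⊠sec·tan^ n q)
           (+-cong (×-congʳ (suc q) (sin⊠sec·tan^ n (suc q)))
                   (trans (×-congʳ q (sin⊠sec·tan^ n (ℕ.pred q))) (suc-pred q))) ⟩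
    tan^ q n + (suc q · tan^ (suc (suc q)) n + q · tan^ q n)
      ≈⟨ solve 3 (λ x y z → x :+ (y :+ z) := y :+ (x :+ z)) refl _ _ _ ⟩
    suc q · tan^ (suc (suc q)) n + suc q · tan^ q n ∎
    where
    open SetoidReasoning setoid
    -- At q = 0 the truncated predecessor gives the wrong power, but the factor 0 in front of it
    -- removes the term.
    suc-pred : ∀ q → q · tan^ (suc (ℕ.pred q)) n ≈ q · tan^ q n
    suc-pred zero    = refl
    suc-pred (suc q) = refl

  secE : Series
  secE = sec·tan^ 0

  cos⊠sec : cosE ⊠ secE ≋ 𝟙
  cos⊠sec zero    = cos⊠sec·tan^ 0 0
  cos⊠sec (suc n) = trans (cos⊠sec·tan^ (suc n) 0) (+-identityˡ 0#)

  -- By definition the derivative is sec tan. Inserting sec · cos = 1 and using cos · (sec tan) =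
  -- tan = sin · sec removes the tangent.
  D-sec : D secE ≋ secE ⊠ secE ⊠ sinE
  D-sec = begin
    D secE                        ≈⟨ (λ n → trans (+-identityʳ _) (+-identityʳ _)) ⟩
    sec·tan^ 1                    ≈⟨ H.sym (H.*-identityˡ _) ⟩
    𝟙 ⊠ sec·tan^ 1                ≈⟨ H.*-congʳ (H.sym cos⊠sec) ⟩
    cosE ⊠ secE ⊠ sec·tan^ 1      ≈⟨ H.*-congʳ (H.*-comm cosE secE) ⟩
    secE ⊠ cosE ⊠ sec·tan^ 1      ≈⟨ H.*-assoc secE cosE (sec·tan^ 1) ⟩
    secE ⊠ (cosE ⊠ sec·tan^ 1)
      ≈⟨ H.*-congˡ (λ n → trans (cos⊠sec·tan^ n 1) (sym (sin⊠sec·tan^ n 0))) ⟩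
    secE ⊠ (sinE ⊠ secE)          ≈⟨ H.*-congˡ (H.*-comm sinE secE) ⟩
    secE ⊠ (secE ⊠ sinE)          ≈⟨ H.sym (H.*-assoc secE secE sinE) ⟩
    secE ⊠ secE ⊠ sinE            ∎
    where open SetoidReasoning H.setoid

-- Series in x, y, z and substitution of linear forms.

module TripleSeries {c ℓ} (R : CommutativeRing c ℓ) where
  private module R = CommutativeRing R
  open Hurwitz R using (Series; _≋_; _⊠_; 𝟙; D)
  open Trigonometric R

  H₁ = Hurwitz.hurwitzRing R
  H₂ = Hurwitz.hurwitzRing H₁
  T  = Hurwitz.hurwitzRing H₂

  open CommutativeRing T
  open RingProperties (CommutativeRing.ring T)
  open SetoidReasoning setoid

  ∂x ∂y ∂z : Carrier → Carrier
  ∂x f i j l = f (suc i) j l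
  ∂y f i j l = f i (suc j) l
  ∂z f i j l = f i j (suc l)

  ∂x-isDerivation : IsDerivation T ∂x
  ∂x-isDerivation = D-isDerivation H₂

  ∂y-isDerivation : IsDerivation T ∂y
  ∂y-isDerivation = coefficientwise-isDerivation H₂ (D-isDerivation H₁)

  ∂z-isDerivation : IsDerivation T ∂z
  ∂z-isDerivation = coefficientwise-isDerivation H₂
    (coefficientwise-isDerivation H₁ (D-isDerivation R))

  -- Used when factors are known only on a coordinate plane. Restriction to x = 0 is evaluation of
  -- the outermost index and commutes with products by definition; y = 0 and z = 0 concern inner
  -- indices.
  *-local : ∀ i j l {f f′ g g′} →
    (∀ i′ j′ l′ → i′ ≤ i → j′ ≤ j → l′ ≤ l → f i′ j′ l′ R.≈ f′ i′ j′ l′) →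
    (∀ i′ j′ l′ → i′ ≤ i → j′ ≤ j → l′ ≤ l → g i′ j′ l′ R.≈ g′ i′ j′ l′) →
    (f * g) i j l R.≈ (f′ * g′) i j l
  *-local zero zero zero p q =
    R.*-cong (p 0 0 0 z≤n z≤n z≤n) (q 0 0 0 z≤n z≤n z≤n)
  *-local zero zero (suc l) {f} {f′} {g} {g′} p q = R.+-cong
    (*-local 0 0 l {∂z f} {∂z f′} {g} {g′}
      (λ i′ j′ l′ a b c → p i′ j′ (suc l′) a b (s≤s c))
      (λ i′ j′ l′ a b c → q i′ j′ l′ a b (m≤n⇒m≤1+n c)))
    (*-local 0 0 l {f} {f′} {∂z g} {∂z g′}
      (λ i′ j′ l′ a b c → p i′ j′ l′ a b (m≤n⇒m≤1+n c))
      (λ i′ j′ l′ a b c → q i′ j′ (suc l′) a b (s≤s c)))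
  *-local zero (suc j) l {f} {f′} {g} {g′} p q = R.+-cong
    (*-local 0 j l {∂y f} {∂y f′} {g} {g′}
      (λ i′ j′ l′ a b c → p i′ (suc j′) l′ a (s≤s b) c)
      (λ i′ j′ l′ a b c → q i′ j′ l′ a (m≤n⇒m≤1+n b) c))
    (*-local 0 j l {f} {f′} {∂y g} {∂y g′}
      (λ i′ j′ l′ a b c → p i′ j′ l′ a (m≤n⇒m≤1+n b) c)
      (λ i′ j′ l′ a b c → q i′ (suc j′) l′ a (s≤s b) c))
  *-local (suc i) j l {f} {f′} {g} {g′} p q = R.+-cong
    (*-local i j l {∂x f} {∂x f′} {g} {g′}
      (λ i′ j′ l′ a b c → p (suc i′) j′ l′ (s≤s a) b c)
      (λ i′ j′ l′ a b c → q i′ j′ l′ (m≤n⇒m≤1+n a) b c))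
    (*-local i j l {f} {f′} {∂x g} {∂x g′}
      (λ i′ j′ l′ a b c → p i′ j′ l′ (m≤n⇒m≤1+n a) b c)
      (λ i′ j′ l′ a b c → q (suc i′) j′ l′ (s≤s a) b c))

  _when_ : R.Carrier → Bool → R.Carrier
  x when b = if b then x else R.0#

  when-cong : ∀ b {x y} → x R.≈ y → x when b R.≈ y when b
  when-cong true  e = e
  when-cong false e = R.refl

  when-neg : ∀ b {x y} → x R.≈ R.- y → x when b R.≈ R.- (y when b)
  when-neg true  e = e
  when-neg false e = R.sym (RingProperties.-0#≈0# R.ring)

  when-comm : ∀ b b′ x → (x when b) when b′ R.≈ (x when b′) when b
  when-comm true  b′    x = R.refl
  when-comm false true  x = R.refl
  when-comm false false x = R.refl

  -- ι p q r f is f(t), t being the sum of those of x, y, z whose flag is true.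
  ι : Bool → Bool → Bool → Series → Carrier
  ι p q r f zero    zero    zero    = f 0
  ι p q r f zero    zero    (suc l) = ι p q r (D f) 0 0 l when r
  ι p q r f zero    (suc j) l       = ι p q r (D f) 0 j l when q
  ι p q r f (suc i) j       l       = ι p q r (D f) i j l when p

  module _ (p q r : Bool) where
    ι-cong : ∀ {f g} → f ≋ g → ι p q r f ≈ ι p q r g
    ι-cong e zero    zero    zero    = e 0
    ι-cong e zero    zero    (suc l) = when-cong r (ι-cong (λ n → e (suc n)) 0 0 l)
    ι-cong e zero    (suc j) l       = when-cong q (ι-cong (λ n → e (suc n)) 0 j l)
    ι-cong e (suc i) j       l       = when-cong p (ι-cong (λ n → e (suc n)) i j l)

    ι-neg : ∀ f → ι p q r (λ n → R.- f n) ≈ - ι p q r f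
    ι-neg f zero    zero    zero    = R.refl
    ι-neg f zero    zero    (suc l) = when-neg r (ι-neg (D f) 0 0 l)
    ι-neg f zero    (suc j) l       = when-neg q (ι-neg (D f) 0 j l)
    ι-neg f (suc i) j       l       = when-neg p (ι-neg (D f) i j l)

    -- The recursion of `ι` removes the exponent of x first, so the chain rule is definitional for
    -- `∂x` only; for the other variables the flags have to be commuted.
    ∂y-ι : ∀ f → ∂y (ι p q r f) ≈ (λ i j l → ι p q r (D f) i j l when q)
    ∂y-ι f zero    j l = R.refl
    ∂y-ι f (suc i) j l =
      R.trans (when-cong p (∂y-ι (D f) i j l)) (when-comm q p _)

    ∂z-ι : ∀ f → ∂z (ι p q r f) ≈ (λ i j l → ι p q r (D f) i j l when r)
    ∂z-ι f zero    zero    l = R.refl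
    ∂z-ι f zero    (suc j) l =
      R.trans (when-cong q (∂z-ι (D f) 0 j l)) (when-comm r q _)
    ∂z-ι f (suc i) j       l =
      R.trans (when-cong p (∂z-ι (D f) i j l)) (when-comm r p _)

    ι-at-x=0 : ∀ p′ f j l → ι p q r f 0 j l R.≈ ι p′ q r f 0 j l
    ι-at-x=0 p′ f zero    zero    = R.refl
    ι-at-x=0 p′ f zero    (suc l) = when-cong r (ι-at-x=0 p′ (D f) 0 l)
    ι-at-x=0 p′ f (suc j) l       = when-cong q (ι-at-x=0 p′ (D f) j l)

    ι-at-y=0 : ∀ q′ f i l → ι p q r f i 0 l R.≈ ι p q′ r f i 0 l
    ι-at-y=0 q′ f zero    zero    = R.refl
    ι-at-y=0 q′ f zero    (suc l) = when-cong r (ι-at-y=0 q′ (D f) 0 l)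
    ι-at-y=0 q′ f (suc i) l       = when-cong p (ι-at-y=0 q′ (D f) i l)

  private
    ι₃ = ι true true true

  -- Every partial derivative of f(x+y+z) is f′(x+y+z), so both sides obey the same Leibniz
  -- recursion in each of the three variables.
  ι₃-* : ∀ f g → ι₃ (f ⊠ g) ≈ ι₃ f * ι₃ g
  ι₃-* f g i j l = R.sym (hom i j l f g)
    where
    ι₃-⊞ : ∀ i j l f g → ι₃ (λ n → f n R.+ g n) i j l R.≈ ι₃ f i j l R.+ ι₃ g i j l
    ι₃-⊞ zero    zero    zero    f g = R.refl
    ι₃-⊞ zero    zero    (suc l) f g = ι₃-⊞ 0 0 l (D f) (D g)
    ι₃-⊞ zero    (suc j) l       f g = ι₃-⊞ 0 j l (D f) (D g)
    ι₃-⊞ (suc i) j       l       f g = ι₃-⊞ i j l (D f) (D g)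

    hom : ∀ i j l f g → (ι₃ f * ι₃ g) i j l R.≈ ι₃ (f ⊠ g) i j l
    step : ∀ i j l f g → (ι₃ (D f) * ι₃ g) i j l R.+ (ι₃ f * ι₃ (D g)) i j l
                         R.≈ ι₃ (D (f ⊠ g)) i j l
    step i j l f g = R.trans (R.+-cong (hom i j l (D f) g) (hom i j l f (D g)))
                             (R.sym (ι₃-⊞ i j l (D f ⊠ g) (f ⊠ D g)))

    hom zero    zero    zero    f g = R.refl
    hom zero    zero    (suc l) f g = step 0 0 l f g
    hom zero    (suc j) l       f g = step 0 j l f g
    hom (suc i) j       l       f g = step i j l f g

  ι₃-0 : ι₃ (λ _ → R.0#) ≈ 0#
  ι₃-0 zero    zero    zero    = R.refl
  ι₃-0 zero    zero    (suc l) = ι₃-0 0 0 l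
  ι₃-0 zero    (suc j) l       = ι₃-0 0 j l
  ι₃-0 (suc i) j       l       = ι₃-0 i j l

  ι₃-𝟙 : ι₃ 𝟙 ≈ 1#
  ι₃-𝟙 zero    zero    zero    = R.refl
  ι₃-𝟙 zero    zero    (suc l) = ι₃-0 0 0 l
  ι₃-𝟙 zero    (suc j) l       = ι₃-0 0 j l
  ι₃-𝟙 (suc i) j       l       = ι₃-0 i j l

  cosx sinx cosz sinz cosyz sinyz cosxyz sinxyz secxyz : Carrier
  cosx   = ι true false false cosE
  sinx   = ι true false false sinE
  cosz   = ι false false true cosE
  sinz   = ι false false true sinE
  cosyz  = ι false true true cosE
  sinyz  = ι false true true sinE
  cosxyz = ι₃ cosE
  sinxyz = ι₃ sinE
  secxyz = ι₃ secE

  cos*sec : cosxyz * secxyz ≈ 1#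
  cos*sec = begin
    cosxyz * secxyz     ≈⟨ sym (ι₃-* cosE secE) ⟩
    ι₃ (cosE ⊠ secE)    ≈⟨ ι-cong true true true cos⊠sec ⟩
    ι₃ 𝟙                ≈⟨ ι₃-𝟙 ⟩
    1#                  ∎

  ∂x-sec : ∂x secxyz ≈ secxyz * secxyz * sinxyz
  ∂x-sec = begin
    ι₃ (D secE)                 ≈⟨ ι-cong true true true D-sec ⟩
    ι₃ (secE ⊠ secE ⊠ sinE)     ≈⟨ ι₃-* (secE ⊠ secE) sinE ⟩
    ι₃ (secE ⊠ secE) * sinxyz   ≈⟨ *-congʳ (ι₃-* secE secE) ⟩
    secxyz * secxyz * sinxyz    ∎

  ∂cosx : ∂x cosx ≈ - sinx
  ∂cosx = ι-neg true false false sinE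

  private module H₂ = CommutativeRing H₂

  cosx-at-0 : cosx 0 H₂.≈ H₂.1#
  cosx-at-0 zero    zero    = R.refl
  cosx-at-0 zero    (suc l) = R.refl
  cosx-at-0 (suc j) l       = R.refl

  sinx-at-0 : ∀ j l → sinx 0 j l R.≈ R.0#
  sinx-at-0 zero    zero    = R.refl
  sinx-at-0 zero    (suc l) = R.refl
  sinx-at-0 (suc j) l       = R.refl

  sinx*-at-0 : ∀ f → (sinx * f) 0 H₂.≈ H₂.0#
  sinx*-at-0 f = H₂.trans (H₂.*-congʳ sinx-at-0) (H₂.zeroˡ (f 0))

  cosx*-at-0 : ∀ f → (cosx * f) 0 H₂.≈ f 0
  cosx*-at-0 f = H₂.trans (H₂.*-congʳ cosx-at-0) (H₂.*-identityˡ (f 0))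

  module _ {C S : Carrier} (∂C : ∂x C ≈ - S) (∂S : ∂x S ≈ C) where
    open CircularPairs T ∂x-isDerivation

    module _ {U : Carrier} (∂U : ∂x U ≈ 0#) where

      -- An element is its value at x = 0 together with its `∂x`. Here the derivative vanishes by
      -- `cos-difference`, and at x = 0 only `C 0` remains.
      cos-addition : C 0 H₂.≈ U 0 → cosx * C + sinx * S ≈ U
      cos-addition e zero    =
        H₂.trans (H₂.+-cong (cosx*-at-0 C) (sinx*-at-0 S)) (H₂.trans (H₂.+-identityʳ (C 0)) e)
      cos-addition e (suc i) j l =
        R.trans (cos-difference {cosx} {sinx} {C} {S} ∂cosx refl ∂C ∂S i j l)
                (R.sym (∂U i j l))

      -- The sine term stands on the right so that consequences can be derived as identities of
      -- commutative semirings, without subtraction.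
      sin-addition : S 0 H₂.≈ U 0 → cosx * S ≈ U + sinx * C
      sin-addition e = begin
        cosx * S                              ≈⟨ sym (+-identityʳ _) ⟩
        cosx * S + 0#                         ≈⟨ +-congˡ (sym (-‿inverseˡ _)) ⟩
        cosx * S + (- (sinx * C) + sinx * C)  ≈⟨ sym (+-assoc _ _ _) ⟩
        cosx * S + - (sinx * C) + sinx * C    ≈⟨ +-congʳ difference ⟩
        U + sinx * C                          ∎
        where
        difference : cosx * S + - (sinx * C) ≈ U
        difference zero    = H₂.trans
          (H₂.+-cong (cosx*-at-0 S) (H₂.-‿cong (sinx*-at-0 C)))
          (H₂.trans (H₂.+-congˡ (RingProperties.-0#≈0# H₂.ring))
                    (H₂.trans (H₂.+-identityʳ (S 0)) e))
        difference (suc i) j l =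
          R.trans (sin-difference {cosx} {sinx} {C} {S} ∂cosx refl ∂C ∂S i j l)
                  (R.sym (∂U i j l))

-- Trigonometric identities behind the boundary relations.

module TrigonometricIdentities {c ℓ} (R : CommutativeRing c ℓ) where
  open CommutativeRing R
  open SetoidReasoning setoid
  open SemiringSolver commutativeSemiring

  -- Dictionary: `cx`, `sx`, `cz` are cos x, sin x, cos z; `c′`, `s′` are cosine and sine of y + z;
  -- `C`, `S`, `K` are cosine, sine and secant of x + y + z.
  module Addition {cx sx cz c′ s′ C S K : Carrier}
           (CK : C * K ≈ 1#) (cos-add : cx * C + sx * S ≈ c′) (sin-add : cx * S ≈ s′ + sx * C)
           (pythagoras : cx * cx + sx * sx ≈ 1#) where

    cx*c′ : cx * c′ ≈ C + sx * s′
    cx*c′ = begin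
      cx * c′
        ≈⟨ *-congˡ (sym cos-add) ⟩
      cx * (cx * C + sx * S)
        ≈⟨ solve 4 (λ cx sx C S → cx :* (cx :* C :+ sx :* S) := cx :* cx :* C :+ sx :* (cx :* S))
             refl cx sx C S ⟩
      cx * cx * C + sx * (cx * S)
        ≈⟨ +-congˡ (*-congˡ sin-add) ⟩
      cx * cx * C + sx * (s′ + sx * C)
        ≈⟨ solve 4 (λ cx sx C s → cx :* cx :* C :+ sx :* (s :+ sx :* C)
                                  := (cx :* cx :+ sx :* sx) :* C :+ sx :* s)
             refl cx sx C s′ ⟩
      (cx * cx + sx * sx) * C + sx * s′
        ≈⟨ +-congʳ (trans (*-congʳ pythagoras) (*-identityˡ C)) ⟩
      C + sx * s′ ∎

    -- The left side is the closed form AU; the right side turns into AL at y = 0, where `s′`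
    -- becomes sin z.
    diagonal-a : cx * (cz * (S * (K * K))) ≈ cz * (sx * K) + cz * s′ * (K * K)
    diagonal-a = begin
      cx * (cz * (S * (K * K)))
        ≈⟨ solve 4 (λ cx cz S K → cx :* (cz :* (S :* (K :* K))) := cx :* S :* (cz :* K :* K))
             refl cx cz S K ⟩
      cx * S * (cz * K * K)
        ≈⟨ *-congʳ sin-add ⟩
      (s′ + sx * C) * (cz * K * K)
        ≈⟨ solve 5 (λ s sx C cz K → (s :+ sx :* C) :* (cz :* K :* K)
                     := C :* K :* (cz :* (sx :* K)) :+ cz :* s :* (K :* K))
             refl s′ sx C cz K ⟩
      C * K * (cz * (sx * K)) + cz * s′ * (K * K)
        ≈⟨ +-congʳ (trans (*-congʳ CK) (*-identityˡ _)) ⟩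
      cz * (sx * K) + cz * s′ * (K * K) ∎

    -- This is BL = BU + 1 at y = 0, with the negative term of BL moved to the right and z replaced
    -- by y + z; in this form it holds for all y.
    diagonal-b : c′ * (c′ * (K * K)) ≈ (sx * (c′ * (S * (K * K))) + 1#) + s′ * (sx * K)
    diagonal-b = begin
      c′ * (c′ * (K * K))
        ≈⟨ *-congʳ (sym cos-add) ⟩
      (cx * C + sx * S) * (c′ * (K * K))
        ≈⟨ solve 6 (λ cx sx c C S K → (cx :* C :+ sx :* S) :* (c :* (K :* K))
                     := sx :* (c :* (S :* (K :* K))) :+ cx :* c :* (C :* K :* K))
             refl cx sx c′ C S K ⟩
      sx * (c′ * (S * (K * K))) + cx * c′ * (C * K * K)
        ≈⟨ +-congˡ (*-cong cx*c′ (trans (*-congʳ CK) (*-identityˡ K))) ⟩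
      sx * (c′ * (S * (K * K))) + (C + sx * s′) * K
        ≈⟨ solve 5 (λ p C s sx K → p :+ (C :+ sx :* s) :* K := (p :+ C :* K) :+ s :* (sx :* K))
             refl (sx * (c′ * (S * (K * K)))) C s′ sx K ⟩
      (sx * (c′ * (S * (K * K))) + C * K) + s′ * (sx * K)
        ≈⟨ +-congʳ (+-congˡ CK) ⟩
      (sx * (c′ * (S * (K * K))) + 1#) + s′ * (sx * K) ∎

    -- Since `K * K * S` is the x-derivative of `K`, this says that sin x sec(x+y+z) has derivative
    -- cos(y+z) sec²(x+y+z), the numerator being cos((x+y+z) - x).
    derivative-of-sin*sec : cx * K + sx * (K * K * S) ≈ c′ * (K * K)
    derivative-of-sin*sec = begin
      cx * K + sx * (K * K * S)
        ≈⟨ +-congʳ (sym (trans (*-congʳ CK) (*-identityˡ _))) ⟩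
      C * K * (cx * K) + sx * (K * K * S)
        ≈⟨ solve 5 (λ cx sx C S K → C :* K :* (cx :* K) :+ sx :* (K :* K :* S)
                     := (cx :* C :+ sx :* S) :* (K :* K)) refl cx sx C S K ⟩
      (cx * C + sx * S) * (K * K)
        ≈⟨ *-congʳ cos-add ⟩
      c′ * (K * K) ∎

    clear-upper : cx * (cz * (S * (K * K))) * C * C ≈ cx * cz * S
    clear-upper = begin
      cx * (cz * (S * (K * K))) * C * C
        ≈⟨ solve 5 (λ cx cz C S K → cx :* (cz :* (S :* (K :* K))) :* C :* C
                     := C :* K :* (C :* K :* (cx :* cz :* S))) refl cx cz C S K ⟩
      C * K * (C * K * (cx * cz * S))
        ≈⟨ trans (*-cong CK (trans (*-congʳ CK) (*-identityˡ _))) (*-identityˡ _) ⟩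
      cx * cz * S ∎

    clear-lower : ∀ sz → (cz * (sx * K) + sz * (c′ * (K * K))) * C * C
                         ≈ cz * sx * C + sz * c′
    clear-lower sz = begin
      (cz * (sx * K) + sz * (c′ * (K * K))) * C * C
        ≈⟨ solve 6 (λ sx cz sz c C K → (cz :* (sx :* K) :+ sz :* (c :* (K :* K))) :* C :* C
                     := C :* K :* (cz :* sx :* C) :+ C :* K :* (C :* K :* (sz :* c)))
             refl sx cz sz c′ C K ⟩
      C * K * (cz * sx * C) + C * K * (C * K * (sz * c′))
        ≈⟨ +-cong (trans (*-congʳ CK) (*-identityˡ _))
             (trans (*-cong CK (trans (*-congʳ CK) (*-identityˡ _))) (*-identityˡ _)) ⟩
      cz * sx * C + sz * c′ ∎

-- The system of recurrences and its uniqueness.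

-- The recurrences satisfied by the coefficients
--   AU i j l = a_n(i+1, i+j+2),  AL i j l = a_n(i+j+2, i+1),
-- where n = i+j+l+3, and likewise by BU, BL for b, on eliminating column sums.
record IsTwinSolution {c ℓ} (R : CommutativeRing c ℓ)
                      (AU BU AL BL : ℕ → ℕ → ℕ → CommutativeRing.Carrier R) : Set ℓ where
  open CommutativeRing R
  field
    au  : ∀ i j l → AU i (suc j) l ≈ AU (suc i) j l + BU i j l
    bu  : ∀ i j l → BU (suc i) j l ≈ BU i (suc j) l + AU i j l
    bu₀ : ∀ j l → BU 0 j l ≈ 0#
    al  : ∀ i j l → AL i j (suc l) ≈ AL i (suc j) l + BL i j l
    bl  : ∀ i j l → BL i (suc j) l ≈ BL i j (suc l) + AL i j l
    aa  : ∀ i l → AU i 0 l ≈ AL i 0 l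
    bb  : ∀ i l → BL i 0 l ≈ BU i 0 l + CommutativeRing.1# (TripleSeries.T R) i 0 l
    al₀ : ∀ j → AL 0 j 0 ≈ 0#
    ab  : ∀ i j → AL (suc i) j 0 ≈ BL i j 0

module _ {c ℓ} (R : CommutativeRing c ℓ)
         {AU BU AL BL AU′ BU′ AL′ BL′ : ℕ → ℕ → ℕ → CommutativeRing.Carrier R}
         (X : IsTwinSolution R AU BU AL BL) (Y : IsTwinSolution R AU′ BU′ AL′ BL′) where
  open CommutativeRing R
  private
    module X = IsTwinSolution X
    module Y = IsTwinSolution Y

    infix 4 _≈[_]_
    _≈[_]_ : (ℕ → ℕ → ℕ → Carrier) → ℕ → (ℕ → ℕ → ℕ → Carrier) → Set ℓ
    f ≈[ n ] g = ∀ i j l → i ℕ.+ j ℕ.+ l ≡ n → f i j l ≈ g i j l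

    record Agree (n : ℕ) : Set ℓ where
      field
        AU≈ : AU ≈[ n ] AU′
        BU≈ : BU ≈[ n ] BU′
        AL≈ : AL ≈[ n ] AL′
        BL≈ : BL ≈[ n ] BL′

    y→x : ∀ i j l {n} → i ℕ.+ suc j ℕ.+ l ≡ n → suc i ℕ.+ j ℕ.+ l ≡ n
    y→x i j l e = ≡.trans (≡.cong (ℕ._+ l) (≡.sym (ℕₚ.+-suc i j))) e

    x→y : ∀ i j l {n} → suc i ℕ.+ j ℕ.+ l ≡ n → i ℕ.+ suc j ℕ.+ l ≡ n
    x→y i j l e = ≡.trans (≡.cong (ℕ._+ l) (ℕₚ.+-suc i j)) e

    y→z : ∀ i j l {n} → i ℕ.+ suc j ℕ.+ l ≡ n → i ℕ.+ j ℕ.+ suc l ≡ n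
    y→z i j l e = ≡.trans (ℕₚ.+-suc (i ℕ.+ j) l) (y→x i j l e)

    z→y : ∀ i j l {n} → i ℕ.+ j ℕ.+ suc l ≡ n → i ℕ.+ suc j ℕ.+ l ≡ n
    z→y i j l e = x→y i j l (≡.trans (≡.sym (ℕₚ.+-suc (i ℕ.+ j) l)) e)

    -- In degree n, BU is reached from x = 0, BL from y = 0 by its link to BU, AL from z = 0, where
    -- it vanishes or is a BL of degree n - 1, and AU from y = 0 by its link to AL. Each move
    -- exchanges one exponent for another and adds a term of degree n - 1. The guard on `lower`
    -- leaves nothing to assume for n = 0.
    module AtLevel (n : ℕ) (lower : ∀ {m} → n ≡ suc m → Agree m) where

      by : ∀ {a a′ b b′ x x′} → x ≈ a + b → x′ ≈ a′ + b′ → a ≈ a′ → b ≈ b′ → x ≈ x′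
      by p q r s = trans p (trans (+-cong r s) (sym q))

      below : ∀ {i j l} {f g : ℕ → ℕ → ℕ → Carrier} → (∀ {m} → Agree m → f ≈[ m ] g) →
        suc (i ℕ.+ j ℕ.+ l) ≡ n → f i j l ≈ g i j l
      below {i} {j} {l} h e = h (lower (≡.sym e)) i j l ≡.refl

      bu≈ : BU ≈[ n ] BU′
      bu≈ zero    j l e = trans (X.bu₀ j l) (sym (Y.bu₀ j l))
      bu≈ (suc i) j l e = by (X.bu i j l) (Y.bu i j l) (bu≈ i (suc j) l (x→y i j l e))
        (below Agree.AU≈ e)

      bl≈ : BL ≈[ n ] BL′
      bl≈ i zero    l e = by (X.bb i l) (Y.bb i l) (bu≈ i 0 l e) refl
      bl≈ i (suc j) l e = by (X.bl i j l) (Y.bl i j l) (bl≈ i j (suc l) (y→z i j l e))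
        (below Agree.AL≈ (y→x i j l e))

      al≈ : AL ≈[ n ] AL′
      al≈ zero    j zero    e = trans (X.al₀ j) (sym (Y.al₀ j))
      al≈ (suc i) j zero    e =
        trans (X.ab i j) (trans (below Agree.BL≈ e) (sym (Y.ab i j)))
      al≈ i       j (suc l) e = by (X.al i j l) (Y.al i j l) (al≈ i (suc j) l (z→y i j l e))
        (below Agree.BL≈ (≡.trans (≡.sym (ℕₚ.+-suc (i ℕ.+ j) l)) e))

      au≈ : AU ≈[ n ] AU′
      au≈ i zero    l e = trans (X.aa i l) (trans (al≈ i 0 l e) (sym (Y.aa i l)))
      au≈ i (suc j) l e = by (X.au i j l) (Y.au i j l) (au≈ (suc i) j l (y→x i j l e))
        (below Agree.BU≈ (y→x i j l e))

    agree : ∀ n → Agree n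
    agree-below : ∀ n {m} → n ≡ suc m → Agree m
    agree n = record { AU≈ = au≈ ; BU≈ = bu≈ ; AL≈ = al≈ ; BL≈ = bl≈ }
      where open AtLevel n (agree-below n)
    agree-below (suc m) ≡.refl = agree m

  upper-unique : ∀ i j l → AU i j l ≈ AU′ i j l
  upper-unique i j l = Agree.AU≈ (agree (i ℕ.+ j ℕ.+ l)) i j l ≡.refl

  lower-unique : ∀ i j l → AL i j l ≈ AL′ i j l
  lower-unique i j l = Agree.AL≈ (agree (i ℕ.+ j ℕ.+ l)) i j l ≡.refl

-- The closed forms solve the system.

module ClosedForm {c ℓ} (R : CommutativeRing c ℓ) where
  private module R = CommutativeRing R
  open TripleSeries R
  open CommutativeRing T
  open RingProperties (CommutativeRing.ring T) using (-0#≈0#)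

  private
    sec² = secxyz * secxyz

    -- `G` is AU at x = 0 with y replaced by x + y; BU vanishes at x = 0, so the upper pair is the
    -- rotation of `0#` and `G`. `L` and `M` are AL and BL at z = 0 with y replaced by y + z.
    G L M : Carrier
    G = cosz * (sinxyz * sec²)
    L = sinx * secxyz
    M = cosyz * sec²

  AU BU AL BL : Carrier
  AU = cosx * G + - (sinx * 0#)
  BU = cosx * 0# + sinx * G
  AL = cosz * L + sinz * M
  BL = cosz * M + - (sinz * L)

  AU≈ : AU ≈ cosx * G
  AU≈ = trans (+-congˡ (trans (-‿cong (zeroʳ sinx)) -0#≈0#)) (+-identityʳ _)

  BU≈ : BU ≈ sinx * G
  BU≈ = trans (+-congʳ (zeroʳ cosx)) (+-identityˡ _)

  private
    module xy = Derivations T ∂x-isDerivation ∂y-isDerivation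
    module zy = Derivations T ∂z-isDerivation ∂y-isDerivation

    xy-agree : ∀ r f → ∂x (ι true true r f) ≈ ∂y (ι true true r f)
    xy-agree r f = sym (∂y-ι true true r f)

    zy-agree : ∀ p f → ∂z (ι p true true f) ≈ ∂y (ι p true true f)
    zy-agree p f = trans (∂z-ι p true true f) (sym (∂y-ι p true true f))

    open Trigonometric R

    module Upper = xy.Rotation {cosx} {sinx} {0#} {G}
      (ι-neg true false false sinE) refl
      (∂y-ι true false false cosE) (∂y-ι true false false sinE)
      refl
      (xy.agree-* (sym (∂y-ι false false true cosE))
        (xy.agree-* (xy-agree true sinE)
          (xy.agree-* (xy-agree true secE) (xy-agree true secE))))

    module Lower = zy.Rotation {cosz} {sinz} {L} {M}
      (trans (∂z-ι false false true cosE) (ι-neg false false true sinE))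
      (∂z-ι false false true sinE)
      (∂y-ι false false true cosE) (∂y-ι false false true sinE)
      (zy.agree-* (trans (∂z-ι true false false sinE) (sym (∂y-ι true false false sinE)))
                  (zy-agree true secE))
      (zy.agree-* (zy-agree false cosE)
        (zy.agree-* (zy-agree true secE) (zy-agree true secE)))

    *-at-x=0 : ∀ {f g} → (∀ j l → f 0 j l R.≈ R.0#) → ∀ j l → (f * g) 0 j l R.≈ R.0#
    *-at-x=0 {f} {g} p j l = R.trans
      (*-local 0 j l {f} {0#} {g} {g} (λ { zero j l z≤n _ _ → p j l }) (λ _ _ _ _ _ _ → R.refl))
      (zeroˡ g 0 j l)

    *-at-z=0 : ∀ {f g} → (∀ i j → f i j 0 R.≈ R.0#) → ∀ i j → (f * g) i j 0 R.≈ R.0#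
    *-at-z=0 {f} {g} p i j = R.trans
      (*-local i j 0 {f} {0#} {g} {g} (λ { i j zero _ _ z≤n → p i j }) (λ _ _ _ _ _ _ → R.refl))
      (zeroˡ g i j 0)

    infix 4 _≈y_
    _≈y_ : Carrier → Carrier → Set ℓ
    f ≈y g = ∀ i l → f i 0 l R.≈ g i 0 l

    *-cong-y : ∀ {f f′ g g′} → f ≈y f′ → g ≈y g′ → f * g ≈y f′ * g′
    *-cong-y {f} {f′} {g} {g′} p q i l = *-local i 0 l {f} {f′} {g} {g′}
      (λ { i zero l _ z≤n _ → p i l }) (λ { i zero l _ z≤n _ → q i l })

    *-congʳ-y : ∀ {f f′} g → f ≈y f′ → f * g ≈y f′ * g
    *-congʳ-y {f} {f′} g p = *-cong-y {f} {f′} {g} {g} p (λ i l → R.refl)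

    *-congˡ-y : ∀ f {g g′} → g ≈y g′ → f * g ≈y f * g′
    *-congˡ-y f {g} {g′} q = *-cong-y {f} {f} {g} {g′} (λ i l → R.refl) q

    cosz≈y : cosz ≈y cosyz
    cosz≈y = ι-at-y=0 false false true true cosE

    sinz≈y : sinz ≈y sinyz
    sinz≈y = ι-at-y=0 false false true true sinE

    sinz-at-z=0 : ∀ i j → sinz i j 0 R.≈ R.0#
    sinz-at-z=0 zero    zero    = R.refl
    sinz-at-z=0 zero    (suc j) = R.refl
    sinz-at-z=0 (suc i) j       = R.refl

    ∂cosxyz : ∂x cosxyz ≈ - sinxyz
    ∂cosxyz = ι-neg true true true sinE

    cos-add : cosx * cosxyz + sinx * sinxyz ≈ cosyz
    cos-add = cos-addition {cosxyz} {sinxyz} ∂cosxyz refl {cosyz} refl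
      (λ j l → ι-at-x=0 true true true false cosE j l)

    sin-add : cosx * sinxyz ≈ sinyz + sinx * cosxyz
    sin-add = sin-addition {cosxyz} {sinxyz} ∂cosxyz refl {sinyz} refl
      (λ j l → ι-at-x=0 true true true false sinE j l)

    pythagoras : cosx * cosx + sinx * sinx ≈ 1#
    pythagoras = cos-addition {cosx} {sinx} (ι-neg true false false sinE) refl {1#} refl cosx-at-0

    module I = TrigonometricIdentities.Addition T {cosx} {sinx} {cosz} {cosyz} {sinyz}
      {cosxyz} {sinxyz} {secxyz} cos*sec cos-add sin-add pythagoras

    aa-closed : AU ≈y AL
    aa-closed i l = R.trans (trans AU≈ I.diagonal-a i 0 l)
      (R.+-congˡ (R.trans
        (*-congʳ-y sec² (λ i l → R.trans
          (*-cong-y {cosz} {cosyz} {sinyz} {sinz} cosz≈y (λ i l → R.sym (sinz≈y i l)) i l)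
          (*-comm cosyz sinz i 0 l)) i l)
        (*-assoc sinz cosyz sec² i 0 l)))

    -- On y = 0 the outer cos z and sin z may be exchanged for those of y + z, which makes
    -- `diagonal-b` applicable; the cos(y+z) left in `G′` is changed back at the end.
    bb-closed : BL ≈y BU + 1#
    bb-closed i l = begin
      BL i 0 l
        ≈⟨ R.+-cong (*-congʳ-y M cosz≈y i l) (R.-‿cong (*-congʳ-y L sinz≈y i l)) ⟩
      (cosyz * M + - (sinyz * L)) i 0 l
        ≈⟨ +-congʳ { - (sinyz * L)} I.diagonal-b i 0 l ⟩
      ((sinx * G′ + 1#) + sinyz * L + - (sinyz * L)) i 0 l
        ≈⟨ +-assoc (sinx * G′ + 1#) (sinyz * L) (- (sinyz * L)) i 0 l ⟩
      ((sinx * G′ + 1#) + (sinyz * L + - (sinyz * L))) i 0 l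
        ≈⟨ trans (+-congˡ (-‿inverseʳ (sinyz * L))) (+-identityʳ (sinx * G′ + 1#)) i 0 l ⟩
      (sinx * G′ + 1#) i 0 l
        ≈⟨ R.+-congʳ (*-congˡ-y sinx (*-congʳ-y (sinxyz * sec²) (λ i l → R.sym (cosz≈y i l))) i l) ⟩
      (sinx * G + 1#) i 0 l
        ≈⟨ R.+-congʳ (R.sym (BU≈ i 0 l)) ⟩
      (BU + 1#) i 0 l ∎
      where
      open SetoidReasoning R.setoid
      G′ = cosyz * (sinxyz * sec²)

    ∂x-constant : ∀ {c} f → ∂x c ≈ 0# → ∂x (c * f) ≈ c * ∂x f
    ∂x-constant {c} f p = trans (+-congʳ (trans (*-congʳ p) (zeroˡ f))) (+-identityˡ _)

    ∂L : ∂x L ≈ M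
    ∂L = trans (+-congˡ (*-congˡ ∂x-sec)) I.derivative-of-sin*sec

    -- At z = 0 the terms with the factor sin z disappear on both sides, and `∂x L` is `M`.
    ab-closed : ∀ i j → AL (suc i) j 0 R.≈ BL i j 0
    ab-closed i j = begin
      ∂x AL i j 0
        ≈⟨ R.+-cong (trans (∂x-constant {cosz} L refl) (*-congˡ ∂L) i j 0)
             (∂x-constant {sinz} M refl i j 0) ⟩
      (cosz * M) i j 0 R.+ (sinz * ∂x M) i j 0
        ≈⟨ R.+-congˡ (*-at-z=0 {sinz} {∂x M} sinz-at-z=0 i j) ⟩
      (cosz * M) i j 0 R.+ R.0#
        ≈⟨ R.+-congˡ (R.sym (R.trans (R.-‿cong (*-at-z=0 {sinz} {L} sinz-at-z=0 i j))
                                     (RingProperties.-0#≈0# R.ring))) ⟩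
      BL i j 0 ∎
      where open SetoidReasoning R.setoid

    al₀-closed : ∀ j → AL 0 j 0 R.≈ R.0#
    al₀-closed j = R.trans
      (R.+-cong
        (R.trans (*-comm cosz L 0 j 0)
                 (*-at-x=0 {L} {cosz} (*-at-x=0 {sinx} {secxyz} sinx-at-0) j 0))
        (*-at-z=0 {sinz} {M} sinz-at-z=0 0 j))
      (R.+-identityˡ R.0#)

  isTwinSolution : IsTwinSolution R AU BU AL BL
  isTwinSolution = record
    { au  = Upper.rotation₂
    ; bu  = Upper.rotation₁
    ; bu₀ = λ j l → R.trans (BU≈ 0 j l) (*-at-x=0 {sinx} {G} sinx-at-0 j l)
    ; al  = Lower.rotation₁
    ; bl  = Lower.rotation₂
    ; aa  = aa-closed
    ; bb  = bb-closed
    ; al₀ = al₀-closed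
    ; ab  = ab-closed
    }

  AU*cos² : AU * cosxyz * cosxyz ≈ cosx * cosz * sinxyz
  AU*cos² = trans (*-congʳ (*-congʳ AU≈)) I.clear-upper

  AL*cos² : AL * cosxyz * cosxyz ≈ cosz * sinx * cosxyz + sinz * cosyz
  AL*cos² = I.clear-lower sinz

-- Natural numbers inside ℚ.

open import Data.Rational using (ℚ; 0ℚ; 1ℚ; _+_; _*_; -_; _/_; toℚᵘ)
open import Data.Rational.Properties
  using (+-*-commutativeRing; toℚᵘ-injective; toℚᵘ-fromℚᵘ; toℚᵘ-homo-+; toℚᵘ-homo-*)
open import Data.Rational.Unnormalised as ℚᵘ using (mkℚᵘ)
import Data.Rational.Unnormalised.Properties as ℚᵘₚ

ℕ→ℚ-+ : ∀ m n → ℕ→ℚ (m ℕ.+ n) ≡ ℕ→ℚ m + ℕ→ℚ n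
ℕ→ℚ-+ m n = toℚᵘ-injective (begin
  toℚᵘ (ℕ→ℚ (m ℕ.+ n))          ≈⟨ toℚᵘ-fromℚᵘ (mkℚᵘ (ℤ.+ (m ℕ.+ n)) 0) ⟩
  mkℚᵘ (ℤ.+ (m ℕ.+ n)) 0
    ≈⟨ ℚᵘ.*≡* (≡.cong (ℤ._* 1ℤ) (≡.sym
         (≡.cong₂ ℤ._+_ (ℤₚ.*-identityʳ (ℤ.+ m)) (ℤₚ.*-identityʳ (ℤ.+ n))))) ⟩
  mkℚᵘ (ℤ.+ m) 0 ℚᵘ.+ mkℚᵘ (ℤ.+ n) 0
    ≈⟨ ℚᵘₚ.+-cong (ℚᵘₚ.≃-sym (toℚᵘ-fromℚᵘ (mkℚᵘ (ℤ.+ m) 0)))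
                  (ℚᵘₚ.≃-sym (toℚᵘ-fromℚᵘ (mkℚᵘ (ℤ.+ n) 0))) ⟩
  toℚᵘ (ℕ→ℚ m) ℚᵘ.+ toℚᵘ (ℕ→ℚ n) ≈⟨ ℚᵘₚ.≃-sym (toℚᵘ-homo-+ (ℕ→ℚ m) (ℕ→ℚ n)) ⟩
  toℚᵘ (ℕ→ℚ m + ℕ→ℚ n)          ∎)
  where open SetoidReasoning ℚᵘₚ.≃-setoid

ℕ→ℚ-* : ∀ m n → ℕ→ℚ (m ℕ.* n) ≡ ℕ→ℚ m * ℕ→ℚ n
ℕ→ℚ-* m n = toℚᵘ-injective (begin
  toℚᵘ (ℕ→ℚ (m ℕ.* n))          ≈⟨ toℚᵘ-fromℚᵘ (mkℚᵘ (ℤ.+ (m ℕ.* n)) 0) ⟩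
  mkℚᵘ (ℤ.+ (m ℕ.* n)) 0        ≈⟨ ℚᵘ.*≡* (≡.cong (ℤ._* 1ℤ) (ℤₚ.pos-* m n)) ⟩
  mkℚᵘ (ℤ.+ m) 0 ℚᵘ.* mkℚᵘ (ℤ.+ n) 0
    ≈⟨ ℚᵘₚ.*-cong (ℚᵘₚ.≃-sym (toℚᵘ-fromℚᵘ (mkℚᵘ (ℤ.+ m) 0)))
                  (ℚᵘₚ.≃-sym (toℚᵘ-fromℚᵘ (mkℚᵘ (ℤ.+ n) 0))) ⟩
  toℚᵘ (ℕ→ℚ m) ℚᵘ.* toℚᵘ (ℕ→ℚ n) ≈⟨ ℚᵘₚ.≃-sym (toℚᵘ-homo-* (ℕ→ℚ m) (ℕ→ℚ n)) ⟩
  toℚᵘ (ℕ→ℚ m * ℕ→ℚ n)          ∎)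
  where open SetoidReasoning ℚᵘₚ.≃-setoid

1/n*n : ∀ n .{{_ : ℕ.NonZero n}} → (ℤ.+ 1 / n) * ℕ→ℚ n ≡ 1ℚ
1/n*n (suc n) = toℚᵘ-injective (begin
  toℚᵘ ((ℤ.+ 1 / suc n) * ℕ→ℚ (suc n))
    ≈⟨ toℚᵘ-homo-* (ℤ.+ 1 / suc n) (ℕ→ℚ (suc n)) ⟩
  toℚᵘ (ℤ.+ 1 / suc n) ℚᵘ.* toℚᵘ (ℕ→ℚ (suc n))
    ≈⟨ ℚᵘₚ.*-cong (toℚᵘ-fromℚᵘ (mkℚᵘ (ℤ.+ 1) n)) (toℚᵘ-fromℚᵘ (mkℚᵘ (ℤ.+ suc n) 0)) ⟩
  mkℚᵘ (ℤ.+ 1) n ℚᵘ.* mkℚᵘ (ℤ.+ suc n) 0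
    ≈⟨ ℚᵘ.*≡* (≡.trans (ℤₚ.*-identityʳ _) (≡.trans (ℤₚ.*-identityˡ _)
         (≡.trans (≡.cong ℤ.+_ (≡.sym (ℕₚ.*-identityʳ (suc n)))) (≡.sym (ℤₚ.*-identityˡ _))))) ⟩
  toℚᵘ 1ℚ ∎)
  where open SetoidReasoning ℚᵘₚ.≃-setoid

-- From the twin Seidel axioms to the system of recurrences.

Σ₁-split : ∀ q p f → Σ₁ (q ℕ.+ p) f ≡ Σ₁ p f ℕ.+ Σ₁ q (λ m → f (m ℕ.+ p))
Σ₁-split zero    p f = ≡.sym (ℕₚ.+-identityʳ _)
Σ₁-split (suc q) p f =
  ≡.trans (≡.cong (ℕ._+ f (suc (q ℕ.+ p))) (Σ₁-split q p f)) (ℕₚ.+-assoc (Σ₁ p f) _ _)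

Σ₁-telescope-down : ∀ p {f g : ℕ → ℕ} →
  (∀ m → 1 ≤ m → m ≤ p → g m ≡ g (suc m) ℕ.+ f m) → Σ₁ p f ℕ.+ g (suc p) ≡ g 1
Σ₁-telescope-down zero            h = ≡.refl
Σ₁-telescope-down (suc p) {f} {g} h = begin
  Σ₁ p f ℕ.+ f (suc p) ℕ.+ g (suc (suc p))
    ≡⟨ ℕₚ.+-assoc (Σ₁ p f) _ _ ⟩
  Σ₁ p f ℕ.+ (f (suc p) ℕ.+ g (suc (suc p)))
    ≡⟨ ≡.cong (Σ₁ p f ℕ.+_) (≡.trans (ℕₚ.+-comm (f (suc p)) _)
                                     (≡.sym (h (suc p) (s≤s z≤n) ℕₚ.≤-refl))) ⟩
  Σ₁ p f ℕ.+ g (suc p)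
    ≡⟨ Σ₁-telescope-down p (λ m u v → h m u (m≤n⇒m≤1+n v)) ⟩
  g 1 ∎
  where open ≡.≡-Reasoning

Σ₁-telescope-up : ∀ p {f g : ℕ → ℕ} →
  (∀ m → 1 ≤ m → m ≤ p → g (suc m) ≡ g m ℕ.+ f m) → g (suc p) ≡ g 1 ℕ.+ Σ₁ p f
Σ₁-telescope-up zero            h = ≡.sym (ℕₚ.+-identityʳ _)
Σ₁-telescope-up (suc p) {f} {g} h = begin
  g (suc (suc p))
    ≡⟨ h (suc p) (s≤s z≤n) ℕₚ.≤-refl ⟩
  g (suc p) ℕ.+ f (suc p)
    ≡⟨ ≡.cong (ℕ._+ f (suc p)) (Σ₁-telescope-up p (λ m u v → h m u (m≤n⇒m≤1+n v))) ⟩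
  g 1 ℕ.+ Σ₁ p f ℕ.+ f (suc p)
    ≡⟨ ℕₚ.+-assoc (g 1) _ _ ⟩
  g 1 ℕ.+ (Σ₁ p f ℕ.+ f (suc p)) ∎
  where open ≡.≡-Reasoning

m+2≤2+i : ∀ {m i} → m ≤ i → m ℕ.+ 2 ≤ 2 ℕ.+ i
m+2≤2+i {m} {i} h = ≡.subst (_≤ 2 ℕ.+ i) (ℕₚ.+-comm 2 m) (s≤s (s≤s h))

3≤m+2 : ∀ {m} → 1 ≤ m → 3 ≤ m ℕ.+ 2
3≤m+2 h = ℕₚ.+-monoˡ-≤ 2 h

module TwinSeidel {a b : Fam} (twin : IsTwinSeidel a b) where
  open IsTwinSeidel twin
  open ≡.≡-Reasoning

  private
    -- Column i + 1 of a matrix of size N = n - 1 has l + 1 entries below the diagonal; `split` cuts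
    -- its sum just after the diagonal entry.
    module Diagonal (i l : ℕ) where
      n N : ℕ
      n = 3 ℕ.+ (l ℕ.+ i)
      N = 2 ℕ.+ (l ℕ.+ i)

      3≤n : 3 ≤ n
      3≤n = s≤s (s≤s (s≤s z≤n))

      i≤l+i : i ≤ l ℕ.+ i
      i≤l+i = ℕₚ.m≤n+m i l

      N≡ : suc l ℕ.+ suc i ≡ N
      N≡ = ≡.cong suc (ℕₚ.+-suc l i)

      2≤i+2 : 2 ≤ suc i ℕ.+ 1
      2≤i+2 = ℕₚ.+-monoˡ-≤ 1 (s≤s z≤n)

      below : ∀ {m} → 1 ≤ m → suc i ℕ.+ 1 ≤ m ℕ.+ suc i
      below {m} h = ≡.subst (_≤ m ℕ.+ suc i) (ℕₚ.+-comm 1 (suc i)) (ℕₚ.+-monoˡ-≤ (suc i) h)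

      split : ∀ f → Σ₁ N f ≡ Σ₁ (suc i) f ℕ.+ Σ₁ (suc l) (λ m → f (m ℕ.+ suc i))
      split f = ≡.trans (≡.cong (λ k → Σ₁ k f) (≡.sym N≡)) (Σ₁-split (suc l) (suc i) f)

  -- Both column sums of (TS4) and (TS5) telescope, which leaves an identity
  -- between the entries next to the diagonal.
  a-diagonal : ∀ i l → 1 ≤ l ℕ.+ i →
    a (3 ℕ.+ (l ℕ.+ i)) (1 ℕ.+ i) (2 ℕ.+ i) ≡ a (3 ℕ.+ (l ℕ.+ i)) (2 ℕ.+ i) (1 ℕ.+ i)
  a-diagonal i l 1≤l+i = ℕₚ.+-cancelˡ-≡ (Σ₁ i f) _ _ (begin
    Σ₁ i f ℕ.+ a n (1 ℕ.+ i) (2 ℕ.+ i)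
      ≡⟨ Σ₁-telescope-down i {f} {λ m → a n m (2 ℕ.+ i)} (λ m u v →
           ts5b n m (2 ℕ.+ i) 3≤n (3≤m+2 u) (m+2≤2+i v) (s≤s (s≤s i≤l+i))) ⟩
    a n 1 (2 ℕ.+ i)
      ≡⟨ ts5a n (2 ℕ.+ i) 3≤n (s≤s (s≤s z≤n)) (s≤s (s≤s i≤l+i)) ⟩
    Σ₁ N f
      ≡⟨ split f ⟩
    Σ₁ i f ℕ.+ f (suc i) ℕ.+ Σ₁ (suc l) (λ m → f (m ℕ.+ suc i))
      -- The diagonal entry of `b` drops out by (TS1), which needs N ≥ 3; this is the hypothesis 1 ≤
      -- l + i.
      ≡⟨ ≡.cong₂ ℕ._+_ (≡.trans (≡.cong (Σ₁ i f ℕ.+_)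
             (ts1b N (suc i) (s≤s (s≤s 1≤l+i)) (s≤s z≤n) (s≤s (m≤n⇒m≤1+n i≤l+i))))
             (ℕₚ.+-identityʳ _))
           (≡.sym (ℕₚ.+-identityʳ _)) ⟩
    Σ₁ i f ℕ.+ (Σ₁ (suc l) (λ m → f (m ℕ.+ suc i)) ℕ.+ 0)
      -- The 0 is read as an entry of the zero last row of A_n, where the telescoping below the
      -- diagonal ends.
      ≡⟨ ≡.cong (λ t → Σ₁ i f ℕ.+ (Σ₁ (suc l) (λ m → f (m ℕ.+ suc i)) ℕ.+ t)) (≡.sym last) ⟩
    Σ₁ i f ℕ.+ (Σ₁ (suc l) (λ m → f (m ℕ.+ suc i)) ℕ.+ a n (suc (suc l) ℕ.+ suc i) (suc i))
      ≡⟨ ≡.cong (Σ₁ i f ℕ.+_)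
           (Σ₁-telescope-down (suc l) {g = λ m → a n (m ℕ.+ suc i) (suc i)} (λ m u v →
             ts5c n (m ℕ.+ suc i) (suc i) 3≤n 2≤i+2 (below u)
               (≡.subst (m ℕ.+ suc i ≤_) N≡ (ℕₚ.+-monoˡ-≤ (suc i) v)))) ⟩
    Σ₁ i f ℕ.+ a n (2 ℕ.+ i) (1 ℕ.+ i) ∎)
    where
    open Diagonal i l
    f : ℕ → ℕ
    f m = b N m (suc i)
    last : a n (suc (suc l) ℕ.+ suc i) (suc i) ≡ 0
    last = ≡.trans (≡.cong (λ m → a n (suc m) (suc i)) N≡)
      (ts2aRow n (suc i) 3≤n (s≤s z≤n) (s≤s (m≤n⇒m≤1+n (m≤n⇒m≤1+n i≤l+i))))

  -- The parts of the column sum above and below the diagonal telescope separately. The diagonal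
  -- entry of `a` is kept because for i = l = 0 it is `a_2(1,1) = 1`.
  b-diagonal : ∀ i l →
    b (3 ℕ.+ (l ℕ.+ i)) (2 ℕ.+ i) (1 ℕ.+ i) ≡
    b (3 ℕ.+ (l ℕ.+ i)) (1 ℕ.+ i) (2 ℕ.+ i) ℕ.+ a (2 ℕ.+ (l ℕ.+ i)) (1 ℕ.+ i) (1 ℕ.+ i)
  b-diagonal i l = ℕₚ.+-cancelʳ-≡ (Σ₁ l F) _ _ (begin
    b n (2 ℕ.+ i) (1 ℕ.+ i) ℕ.+ Σ₁ l F
      ≡⟨ ≡.sym (Σ₁-telescope-up l {F} {λ m → b n (m ℕ.+ suc i) (suc i)} (λ m u v →
           ts4c n (m ℕ.+ suc i) (suc i) 3≤n 2≤i+2 (below u)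
             (≡.subst (m ℕ.+ suc i ≤_) (ℕₚ.+-suc l i) (ℕₚ.+-monoˡ-≤ (suc i) v)))) ⟩
    b n (suc l ℕ.+ suc i) (suc i)
      ≡⟨ ≡.cong (λ m → b n m (suc i)) N≡ ⟩
    b n N (suc i)
      ≡⟨ ts4b n (suc i) 3≤n (s≤s z≤n) (s≤s i≤l+i) ⟩
    Σ₁ N f
      ≡⟨ split f ⟩
    Σ₁ i f ℕ.+ f (suc i) ℕ.+ (Σ₁ l F ℕ.+ F (suc l))
      ≡⟨ ≡.cong₂ ℕ._+_ (≡.cong (ℕ._+ f (suc i)) (≡.sym first))
           (≡.trans (≡.cong (Σ₁ l F ℕ.+_) (≡.trans (≡.cong (λ m → a N m (suc i)) N≡) (last l i)))
                    (ℕₚ.+-identityʳ _)) ⟩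
    b n (1 ℕ.+ i) (2 ℕ.+ i) ℕ.+ f (suc i) ℕ.+ Σ₁ l F ∎)
    where
    open Diagonal i l
    f F : ℕ → ℕ
    f m = a N m (suc i)
    F m = f (m ℕ.+ suc i)
    first : b n (1 ℕ.+ i) (2 ℕ.+ i) ≡ Σ₁ i f
    first = ≡.trans
      (Σ₁-telescope-up i {f} {λ m → b n m (2 ℕ.+ i)} (λ m u v →
        ts4d n m (2 ℕ.+ i) 3≤n (3≤m+2 u) (m+2≤2+i v) (s≤s (s≤s i≤l+i))))
      (≡.cong (ℕ._+ Σ₁ i f)
        (ts2bRow n (2 ℕ.+ i) 3≤n (s≤s z≤n) (s≤s (s≤s (m≤n⇒m≤1+n i≤l+i)))))
    last : ∀ l i → a (2 ℕ.+ (l ℕ.+ i)) (2 ℕ.+ (l ℕ.+ i)) (suc i) ≡ 0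
    -- Here the smaller matrix is A_2, which (TS2) does not cover.
    last zero    zero    = ts3a21
    last zero    (suc i) =
      ts2aRow (3 ℕ.+ i) (2 ℕ.+ i) (s≤s (s≤s (s≤s z≤n))) (s≤s z≤n) (ℕₚ.n≤1+n _)
    last (suc l) i       =
      ts2aRow (3 ℕ.+ (l ℕ.+ i)) (suc i) (s≤s (s≤s (s≤s z≤n))) (s≤s z≤n)
        (s≤s (m≤n⇒m≤1+n (m≤n⇒m≤1+n (ℕₚ.m≤n+m i l))))

  -- The last row of A vanishes, so (TS5) leaves an entry of the last row of B; by (TS4) this entry
  -- and the claimed one are the same column sum of the preceding A.
  a-border : ∀ i j →
    a (4 ℕ.+ (i ℕ.+ j)) (3 ℕ.+ (i ℕ.+ j)) (2 ℕ.+ i) ≡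
    b (3 ℕ.+ (i ℕ.+ j)) (2 ℕ.+ (i ℕ.+ j)) (1 ℕ.+ i)
  a-border i j = begin
    a (4 ℕ.+ s) (3 ℕ.+ s) (2 ℕ.+ i)
      ≡⟨ ts5c (4 ℕ.+ s) (3 ℕ.+ s) (2 ℕ.+ i) 3≤ (s≤s (s≤s z≤n))
           (≡.subst (_≤ 3 ℕ.+ s) (ℕₚ.+-comm 1 (2 ℕ.+ i)) (s≤s (s≤s (s≤s i≤s)))) ℕₚ.≤-refl ⟩
    a (4 ℕ.+ s) (4 ℕ.+ s) (2 ℕ.+ i) ℕ.+ b (3 ℕ.+ s) (3 ℕ.+ s) (2 ℕ.+ i)
      ≡⟨ ≡.cong (ℕ._+ b (3 ℕ.+ s) (3 ℕ.+ s) (2 ℕ.+ i)) (ts2aRow (4 ℕ.+ s) (2 ℕ.+ i) 3≤ (s≤s z≤n)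
           (s≤s (s≤s (m≤n⇒m≤1+n (m≤n⇒m≤1+n i≤s))))) ⟩
    b (3 ℕ.+ s) (3 ℕ.+ s) (2 ℕ.+ i)
      ≡⟨ ts4a (3 ℕ.+ s) (2 ℕ.+ i) 3≤ (s≤s (s≤s z≤n)) (s≤s (s≤s i≤s)) ⟩
    colSum a (2 ℕ.+ s) (1 ℕ.+ i)
      ≡⟨ ≡.sym (ts4b (3 ℕ.+ s) (1 ℕ.+ i) 3≤ (s≤s z≤n) (s≤s i≤s)) ⟩
    b (3 ℕ.+ s) (2 ℕ.+ s) (1 ℕ.+ i) ∎
    where
    s = i ℕ.+ j
    i≤s : i ≤ s
    i≤s = ℕₚ.m≤m+n i j
    3≤ : ∀ {m} → 3 ≤ 3 ℕ.+ m
    3≤ = s≤s (s≤s (s≤s z≤n))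

  a-corner : ∀ j → a (4 ℕ.+ j) (3 ℕ.+ j) 1 ≡ 0
  a-corner j = begin
    a (4 ℕ.+ j) (3 ℕ.+ j) 1
      ≡⟨ ts5c (4 ℕ.+ j) (3 ℕ.+ j) 1 3≤ (s≤s (s≤s z≤n)) (s≤s (s≤s z≤n)) ℕₚ.≤-refl ⟩
    a (4 ℕ.+ j) (4 ℕ.+ j) 1 ℕ.+ b (3 ℕ.+ j) (3 ℕ.+ j) 1
      ≡⟨ ≡.cong₂ ℕ._+_ (ts2aRow (4 ℕ.+ j) 1 3≤ (s≤s z≤n) (s≤s z≤n)) (ts2bCorner (3 ℕ.+ j) 3≤) ⟩
    0 ∎
    where
    3≤ : ∀ {m} → 3 ≤ 3 ℕ.+ m
    3≤ = s≤s (s≤s (s≤s z≤n))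

  -- The theorem involves only a_n with n even, hence b_n with n odd; the
  -- entries of the other parity are replaced by zero.
  aᵉ bᵒ : ℕ → ℕ → ℕ → ℚ
  aᵉ n m k = if even n then ℕ→ℚ (a n m k) else 0ℚ
  bᵒ n m k = if even n then 0ℚ else ℕ→ℚ (b n m k)

  AU BU AL BL : ℕ → ℕ → ℕ → ℚ
  AU i j l = aᵉ (3 ℕ.+ (i ℕ.+ j ℕ.+ l)) (1 ℕ.+ i) (2 ℕ.+ (i ℕ.+ j))
  BU i j l = bᵒ (3 ℕ.+ (i ℕ.+ j ℕ.+ l)) (1 ℕ.+ i) (2 ℕ.+ (i ℕ.+ j))
  AL i j l = aᵉ (3 ℕ.+ (i ℕ.+ j ℕ.+ l)) (2 ℕ.+ (i ℕ.+ j)) (1 ℕ.+ i)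
  BL i j l = bᵒ (3 ℕ.+ (i ℕ.+ j ℕ.+ l)) (2 ℕ.+ (i ℕ.+ j)) (1 ℕ.+ i)

  private
    even-suc : ∀ n → even (suc n) ≡ not (even n)
    even-suc zero          = ≡.refl
    even-suc (suc zero)    = ≡.refl
    even-suc (suc (suc n)) = even-suc n

    -- The index drops by one between `a` and `b`, so either all three terms are genuine entries or
    -- all three are replaced by zero.
    aᵉ-step : ∀ n {m k m′ k′ m″ k″} → a (suc n) m k ≡ a (suc n) m′ k′ ℕ.+ b n m″ k″ →
      aᵉ (suc n) m k ≡ aᵉ (suc n) m′ k′ + bᵒ n m″ k″
    aᵉ-step n {m′ = m′} {k′} {m″} {k″} e rewrite even-suc n with even n
    ... | true  = ≡.refl
    ... | false = ≡.trans (≡.cong ℕ→ℚ e) (ℕ→ℚ-+ (a (suc n) m′ k′) (b n m″ k″))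

    bᵒ-step : ∀ n {m k m′ k′ m″ k″} → b (suc n) m k ≡ b (suc n) m′ k′ ℕ.+ a n m″ k″ →
      bᵒ (suc n) m k ≡ bᵒ (suc n) m′ k′ + aᵉ n m″ k″
    bᵒ-step n {m′ = m′} {k′} {m″} {k″} e rewrite even-suc n with even n
    ... | true  = ≡.trans (≡.cong ℕ→ℚ e) (ℕ→ℚ-+ (b (suc n) m′ k′) (a n m″ k″))
    ... | false = ≡.refl

    3≤4+ : ∀ {m} → 3 ≤ 4 ℕ.+ m
    3≤4+ = s≤s (s≤s (s≤s z≤n))

    i+2≤ : ∀ i j → suc i ℕ.+ 2 ≤ 3 ℕ.+ (i ℕ.+ j)
    i+2≤ i j = m+2≤2+i {suc i} (s≤s (ℕₚ.m≤m+n i j))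

    i+1≤ : ∀ i j → suc i ℕ.+ 1 ≤ 2 ℕ.+ (i ℕ.+ j)
    i+1≤ i j = ≡.subst (_≤ 2 ℕ.+ (i ℕ.+ j)) (ℕₚ.+-comm 1 (suc i)) (s≤s (s≤s (ℕₚ.m≤m+n i j)))

    2≤i+1 : ∀ i → 2 ≤ suc i ℕ.+ 1
    2≤i+1 i = ℕₚ.+-monoˡ-≤ 1 (s≤s z≤n)

    au : ∀ i j l → AU i (suc j) l ≡ AU (suc i) j l + BU i j l
    au i j l rewrite ℕₚ.+-suc i j = aᵉ-step (3 ℕ.+ (i ℕ.+ j ℕ.+ l))
      (ts5b (4 ℕ.+ (i ℕ.+ j ℕ.+ l)) (suc i) (3 ℕ.+ (i ℕ.+ j)) 3≤4+ (3≤m+2 {suc i} (s≤s z≤n))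
        (i+2≤ i j) (ℕₚ.+-monoʳ-≤ 3 (ℕₚ.m≤m+n (i ℕ.+ j) l)))

    bu : ∀ i j l → BU (suc i) j l ≡ BU i (suc j) l + AU i j l
    bu i j l rewrite ℕₚ.+-suc i j = bᵒ-step (3 ℕ.+ (i ℕ.+ j ℕ.+ l))
      (ts4d (4 ℕ.+ (i ℕ.+ j ℕ.+ l)) (suc i) (3 ℕ.+ (i ℕ.+ j)) 3≤4+ (3≤m+2 {suc i} (s≤s z≤n))
        (i+2≤ i j) (ℕₚ.+-monoʳ-≤ 3 (ℕₚ.m≤m+n (i ℕ.+ j) l)))

    bu₀ : ∀ j l → BU 0 j l ≡ 0ℚ
    bu₀ j l with even (3 ℕ.+ (j ℕ.+ l))
    ... | true  = ≡.refl
    ... | false = ≡.cong ℕ→ℚ (ts2bRow (3 ℕ.+ (j ℕ.+ l)) (2 ℕ.+ j) (s≤s (s≤s (s≤s z≤n)))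
      (s≤s z≤n) (s≤s (s≤s (m≤n⇒m≤1+n (ℕₚ.m≤m+n j l)))))

    al : ∀ i j l → AL i j (suc l) ≡ AL i (suc j) l + BL i j l
    al i j l rewrite ℕₚ.+-suc (i ℕ.+ j) l | ℕₚ.+-suc i j = aᵉ-step (3 ℕ.+ (i ℕ.+ j ℕ.+ l))
      (ts5c (4 ℕ.+ (i ℕ.+ j ℕ.+ l)) (2 ℕ.+ (i ℕ.+ j)) (suc i) 3≤4+ (2≤i+1 i) (i+1≤ i j)
        (ℕₚ.+-mono-≤ {2} {3} (s≤s (s≤s z≤n)) (ℕₚ.m≤m+n (i ℕ.+ j) l)))

    bl : ∀ i j l → BL i (suc j) l ≡ BL i j (suc l) + AL i j l
    bl i j l rewrite ℕₚ.+-suc (i ℕ.+ j) l | ℕₚ.+-suc i j = bᵒ-step (3 ℕ.+ (i ℕ.+ j ℕ.+ l))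
      (ts4c (4 ℕ.+ (i ℕ.+ j ℕ.+ l)) (2 ℕ.+ (i ℕ.+ j)) (suc i) 3≤4+ (2≤i+1 i) (i+1≤ i j)
        (ℕₚ.+-monoʳ-≤ 2 (ℕₚ.m≤m+n (i ℕ.+ j) l)))

    aa : ∀ i l → AU i 0 l ≡ AL i 0 l
    aa i l rewrite ℕₚ.+-identityʳ i | ℕₚ.+-comm i l with even (3 ℕ.+ (l ℕ.+ i)) in p
    ... | false = ≡.refl
    ... | true  = ≡.cong ℕ→ℚ (a-diagonal i l (positive (l ℕ.+ i) p))
      where
      -- Evenness excludes n = 3, which supplies the hypothesis of `a-diagonal`.
      positive : ∀ s → even (3 ℕ.+ s) ≡ true → 1 ≤ s
      positive (suc s) e = s≤s z≤n

    bb : ∀ i l → BL i 0 l ≡ BU i 0 l + CommutativeRing.1# (TripleSeries.T +-*-commutativeRing) i 0 l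
    bb i l rewrite ℕₚ.+-identityʳ i | ℕₚ.+-comm i l =
      ≡.trans (bᵒ-step (2 ℕ.+ (l ℕ.+ i)) (b-diagonal i l))
        (≡.cong (bᵒ (3 ℕ.+ (l ℕ.+ i)) (1 ℕ.+ i) (2 ℕ.+ i) +_) (diagonal i l))
      where
      vanish : ∀ s i → suc i ≤ 3 ℕ.+ s → aᵉ (3 ℕ.+ s) (suc i) (suc i) ≡ 0ℚ
      vanish s i h with even (3 ℕ.+ s)
      ... | true  = ≡.cong ℕ→ℚ (ts1a (3 ℕ.+ s) (suc i) (s≤s (s≤s (s≤s z≤n))) (s≤s z≤n) h)
      ... | false = ≡.refl
      diagonal : ∀ i l → aᵉ (2 ℕ.+ (l ℕ.+ i)) (suc i) (suc i) ≡
        CommutativeRing.1# (TripleSeries.T +-*-commutativeRing) i 0 l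
      diagonal zero    zero    = ≡.cong ℕ→ℚ ts3a11
      diagonal (suc i) zero    = vanish i (suc i) (s≤s (s≤s (ℕₚ.n≤1+n i)))
      diagonal zero    (suc l) = vanish (l ℕ.+ 0) 0 (s≤s z≤n)
      diagonal (suc i) (suc l) = vanish (l ℕ.+ suc i) (suc i)
        (s≤s (m≤n⇒m≤1+n (m≤n⇒m≤1+n (ℕₚ.m≤n+m (suc i) l))))

    al₀ : ∀ j → AL 0 j 0 ≡ 0ℚ
    -- Only the parity convention makes this 0: (TS5) gives `a_3(2,1) = b_2(2,1) = 1`.
    al₀ zero    = ≡.refl
    al₀ (suc j) rewrite ℕₚ.+-identityʳ j with even (4 ℕ.+ j)
    ... | true  = ≡.cong ℕ→ℚ (a-corner j)
    ... | false = ≡.refl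

    ab : ∀ i j → AL (suc i) j 0 ≡ BL i j 0
    ab i j rewrite ℕₚ.+-identityʳ (i ℕ.+ j) | even-suc (3 ℕ.+ (i ℕ.+ j))
      with even (3 ℕ.+ (i ℕ.+ j))
    ... | true  = ≡.refl
    ... | false = ≡.cong ℕ→ℚ (a-border i j)

  isTwinSolution : IsTwinSolution +-*-commutativeRing AU BU AL BL
  isTwinSolution = record
    { au = au ; bu = bu ; bu₀ = bu₀ ; al = al ; bl = bl
    ; aa = aa ; bb = bb ; al₀ = al₀ ; ab = ab }

-- Leibniz rules for the convolution product.

module ℚ-Ring = CommutativeRing +-*-commutativeRing
open SemiringSolver ℚ-Ring.commutativeSemiring using (solve; _:+_; _:*_; _:=_)

-- Sums over i + j = n with both indices carried along, which keeps truncated subtraction out of the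
-- inductions.
antidiagonal : ℕ → (ℕ → ℕ → ℚ) → ℚ
antidiagonal zero    φ = φ 0 0
antidiagonal (suc n) φ = φ 0 (suc n) + antidiagonal n (λ i j → φ (suc i) j)

antidiagonal-cong : ∀ n {φ ψ} → (∀ i j → φ i j ≡ ψ i j) → antidiagonal n φ ≡ antidiagonal n ψ
antidiagonal-cong zero    e = e 0 0
antidiagonal-cong (suc n) e =
  ≡.cong₂ _+_ (e 0 (suc n)) (antidiagonal-cong n (λ i j → e (suc i) j))

antidiagonal-+ : ∀ n φ ψ →
  antidiagonal n (λ i j → φ i j + ψ i j) ≡ antidiagonal n φ + antidiagonal n ψ
antidiagonal-+ zero    φ ψ = ≡.refl
antidiagonal-+ (suc n) φ ψ = ≡.trans
  (≡.cong (φ 0 (suc n) + ψ 0 (suc n) +_)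
    (antidiagonal-+ n (λ i j → φ (suc i) j) (λ i j → ψ (suc i) j)))
  (interchange (φ 0 (suc n)) (ψ 0 (suc n)) _ _)
  where open CommutativeSemigroupProperties ℚ-Ring.+-commutativeSemigroup

antidiagonal-* : ∀ n s φ → s * antidiagonal n φ ≡ antidiagonal n (λ i j → s * φ i j)
antidiagonal-* zero    s φ = ≡.refl
antidiagonal-* (suc n) s φ = ≡.trans (ℚ-Ring.distribˡ s (φ 0 (suc n)) _)
  (≡.cong (s * φ 0 (suc n) +_) (antidiagonal-* n s (λ i j → φ (suc i) j)))

Σ₀-cong : ∀ n {f g : ℕ → ℚ} → (∀ i → f i ≡ g i) → Σ₀ n f ≡ Σ₀ n g
Σ₀-cong zero    e = e 0
Σ₀-cong (suc n) e = ≡.cong₂ _+_ (Σ₀-cong n e) (e (suc n))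

Σ₀-head : ∀ n f → Σ₀ (suc n) f ≡ f 0 + Σ₀ n (λ i → f (suc i))
Σ₀-head zero    f = ≡.refl
Σ₀-head (suc n) f = ≡.trans (≡.cong (_+ f (suc (suc n))) (Σ₀-head n f)) (ℚ-Ring.+-assoc (f 0) _ _)

Σ₀-antidiagonal : ∀ n φ → Σ₀ n (λ i → φ i (n ℕ.∸ i)) ≡ antidiagonal n φ
Σ₀-antidiagonal zero    φ = ≡.refl
Σ₀-antidiagonal (suc n) φ = ≡.trans (Σ₀-head n (λ i → φ i (suc n ℕ.∸ i)))
  (≡.cong (φ 0 (suc n) +_) (Σ₀-antidiagonal n (λ i j → φ (suc i) j)))

-- On the antidiagonal the factor n + 1 is the sum of the two indices; each half loses its term with
-- index 0 and is reindexed.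
antidiagonal-leibniz : ∀ n φ → ℕ→ℚ (suc n) * antidiagonal (suc n) φ ≡
  antidiagonal n (λ i j → ℕ→ℚ (suc i) * φ (suc i) j) +
  antidiagonal n (λ i j → ℕ→ℚ (suc j) * φ i (suc j))
antidiagonal-leibniz zero    φ =
  ≡.trans (ℚ-Ring.distribˡ (ℕ→ℚ 1) (φ 0 1) (φ 1 0)) (ℚ-Ring.+-comm (ℕ→ℚ 1 * φ 0 1) _)
antidiagonal-leibniz (suc n) φ = begin
  ℕ→ℚ (2 ℕ.+ n) * (φ 0 (2 ℕ.+ n) + A)
    ≡⟨ ℚ-Ring.distribˡ (ℕ→ℚ (2 ℕ.+ n)) (φ 0 (2 ℕ.+ n)) A ⟩
  p + ℕ→ℚ (2 ℕ.+ n) * A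
    ≡⟨ ≡.cong (p +_) (weight (suc n) A) ⟩
  p + (A + ℕ→ℚ (suc n) * A)
    ≡⟨ ≡.cong (λ t → p + (A + t)) (antidiagonal-leibniz n φ⁺) ⟩
  p + ((φ 1 (suc n) + B) + (C + E))
    ≡⟨ solve 5 (λ p q b c e → p :+ ((q :+ b) :+ (c :+ e)) := (q :+ (b :+ c)) :+ (p :+ e))
         ≡.refl p (φ 1 (suc n)) B C E ⟩
  (φ 1 (suc n) + (B + C)) + (p + E)
    ≡⟨ ≡.cong (λ t → t + (p + E)) (≡.cong₂ _+_ (≡.sym (ℚ-Ring.*-identityˡ (φ 1 (suc n))))
         (≡.trans (≡.sym (antidiagonal-+ n (λ i j → φ (2 ℕ.+ i) j) _))
           (antidiagonal-cong n (λ i j → ≡.sym (weight (suc i) (φ (2 ℕ.+ i) j)))))) ⟩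
  (ℕ→ℚ 1 * φ 1 (suc n) + antidiagonal n (λ i j → ℕ→ℚ (2 ℕ.+ i) * φ (2 ℕ.+ i) j)) + (p + E) ∎
  where
  open ≡.≡-Reasoning
  φ⁺ : ℕ → ℕ → ℚ
  φ⁺ i j = φ (suc i) j
  p A B C E : ℚ
  p = ℕ→ℚ (2 ℕ.+ n) * φ 0 (2 ℕ.+ n)
  A = antidiagonal (suc n) φ⁺
  B = antidiagonal n (λ i j → φ (2 ℕ.+ i) j)
  C = antidiagonal n (λ i j → ℕ→ℚ (suc i) * φ (2 ℕ.+ i) j)
  E = antidiagonal n (λ i j → ℕ→ℚ (suc j) * φ (suc i) (suc j))
  weight : ∀ k x → ℕ→ℚ (suc k) * x ≡ x + ℕ→ℚ k * x
  weight k x = ≡.trans (≡.cong (_* x) (ℕ→ℚ-+ 1 k))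
    (≡.trans (ℚ-Ring.distribʳ x 1ℚ (ℕ→ℚ k)) (≡.cong (_+ ℕ→ℚ k * x) (ℚ-Ring.*-identityˡ x)))

convolve : ((ℕ → ℕ → ℕ → ℕ → ℕ → ℕ → ℚ)) → PS3
convolve Φ i j l = antidiagonal i λ a a′ → antidiagonal j λ b b′ → antidiagonal l λ c c′ →
  Φ a b c a′ b′ c′

⊛-antidiagonal : ∀ f g i j l → (f ⊛ g) i j l ≡
  convolve (λ a b c a′ b′ c′ → f a b c * g a′ b′ c′) i j l
⊛-antidiagonal f g i j l = ≡.trans
  (Σ₀-cong i λ a → ≡.trans
    (Σ₀-cong j λ b → Σ₀-antidiagonal l λ c c′ → f a b c * g (i ℕ.∸ a) (j ℕ.∸ b) c′)
    (Σ₀-antidiagonal j λ b b′ → antidiagonal l λ c c′ → f a b c * g (i ℕ.∸ a) b′ c′))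
  (Σ₀-antidiagonal i λ a a′ → antidiagonal j λ b b′ → antidiagonal l λ c c′ →
    f a b c * g a′ b′ c′)

-- Formal partial derivatives in ordinary coefficients; their integer factors are what the factorial
-- weights absorb.
dx dy dz : PS3 → PS3
dx f i j l = ℕ→ℚ (suc i) * f (suc i) j l
dy f i j l = ℕ→ℚ (suc j) * f i (suc j) l
dz f i j l = ℕ→ℚ (suc l) * f i j (suc l)

module _ (f g : PS3) where
  open CommutativeSemigroupProperties ℚ-Ring.*-commutativeSemigroup using (x∙yz≈y∙xz)
  open ≡.≡-Reasoning

  private
    φ : ℕ → ℕ → ℕ → ℕ → ℕ → ℕ → ℚ
    φ a b c a′ b′ c′ = f a b c * g a′ b′ c′

    assoc : ∀ s x y → s * (x * y) ≡ s * x * y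
    assoc s x y = ≡.sym (ℚ-Ring.*-assoc s x y)

    antidiagonal-*₂ : ∀ j l s (χ : ℕ → ℕ → ℕ → ℕ → ℚ) →
      s * (antidiagonal j λ b b′ → antidiagonal l (χ b b′)) ≡
      antidiagonal j λ b b′ → antidiagonal l λ c c′ → s * χ b b′ c c′
    antidiagonal-*₂ j l s χ = ≡.trans (antidiagonal-* j s _)
      (antidiagonal-cong j λ b b′ → antidiagonal-* l s (χ b b′))

  leibniz-x : ∀ i j l → dx (f ⊛ g) i j l ≡ (dx f ⊛ g) i j l + (f ⊛ dx g) i j l
  leibniz-x i j l = begin
    ℕ→ℚ (suc i) * (f ⊛ g) (suc i) j l
      ≡⟨ ≡.cong (ℕ→ℚ (suc i) *_) (⊛-antidiagonal f g (suc i) j l) ⟩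
    ℕ→ℚ (suc i) * convolve φ (suc i) j l
      ≡⟨ antidiagonal-leibniz i (λ a a′ →
           antidiagonal j λ b b′ → antidiagonal l λ c c′ → φ a b c a′ b′ c′) ⟩
    _ ≡⟨ ≡.cong₂ _+_
           (antidiagonal-cong i λ a a′ → ≡.trans
             (antidiagonal-*₂ j l (ℕ→ℚ (suc a)) (λ b b′ c c′ → φ (suc a) b c a′ b′ c′))
             (antidiagonal-cong j λ b b′ → antidiagonal-cong l λ c c′ →
               assoc (ℕ→ℚ (suc a)) (f (suc a) b c) (g a′ b′ c′)))
           (antidiagonal-cong i λ a a′ → ≡.trans
             (antidiagonal-*₂ j l (ℕ→ℚ (suc a′)) (λ b b′ c c′ → φ a b c (suc a′) b′ c′))
             (antidiagonal-cong j λ b b′ → antidiagonal-cong l λ c c′ →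
               x∙yz≈y∙xz (ℕ→ℚ (suc a′)) (f a b c) (g (suc a′) b′ c′))) ⟩
    convolve (λ a b c a′ b′ c′ → dx f a b c * g a′ b′ c′) i j l +
    convolve (λ a b c a′ b′ c′ → f a b c * dx g a′ b′ c′) i j l
      ≡⟨ ≡.sym (≡.cong₂ _+_ (⊛-antidiagonal (dx f) g i j l) (⊛-antidiagonal f (dx g) i j l)) ⟩
    (dx f ⊛ g) i j l + (f ⊛ dx g) i j l ∎

  leibniz-y : ∀ i j l → dy (f ⊛ g) i j l ≡ (dy f ⊛ g) i j l + (f ⊛ dy g) i j l
  leibniz-y i j l = begin
    ℕ→ℚ (suc j) * (f ⊛ g) i (suc j) l
      ≡⟨ ≡.cong (ℕ→ℚ (suc j) *_) (⊛-antidiagonal f g i (suc j) l) ⟩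
    ℕ→ℚ (suc j) * convolve φ i (suc j) l
      ≡⟨ antidiagonal-* i (ℕ→ℚ (suc j)) _ ⟩
    _ ≡⟨ antidiagonal-cong i (λ a a′ → ≡.trans
           (antidiagonal-leibniz j (λ b b′ → antidiagonal l λ c c′ → φ a b c a′ b′ c′))
           (≡.cong₂ _+_
             (antidiagonal-cong j λ b b′ → ≡.trans
               (antidiagonal-* l (ℕ→ℚ (suc b)) (λ c c′ → φ a (suc b) c a′ b′ c′))
               (antidiagonal-cong l λ c c′ →
                 assoc (ℕ→ℚ (suc b)) (f a (suc b) c) (g a′ b′ c′)))
             (antidiagonal-cong j λ b b′ → ≡.trans
               (antidiagonal-* l (ℕ→ℚ (suc b′)) (λ c c′ → φ a b c a′ (suc b′) c′))
               (antidiagonal-cong l λ c c′ →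
                 x∙yz≈y∙xz (ℕ→ℚ (suc b′)) (f a b c) (g a′ (suc b′) c′))))) ⟩
    _ ≡⟨ antidiagonal-+ i _ _ ⟩
    convolve (λ a b c a′ b′ c′ → dy f a b c * g a′ b′ c′) i j l +
    convolve (λ a b c a′ b′ c′ → f a b c * dy g a′ b′ c′) i j l
      ≡⟨ ≡.sym (≡.cong₂ _+_ (⊛-antidiagonal (dy f) g i j l) (⊛-antidiagonal f (dy g) i j l)) ⟩
    (dy f ⊛ g) i j l + (f ⊛ dy g) i j l ∎

  leibniz-z : ∀ i j l → dz (f ⊛ g) i j l ≡ (dz f ⊛ g) i j l + (f ⊛ dz g) i j l
  leibniz-z i j l = begin
    ℕ→ℚ (suc l) * (f ⊛ g) i j (suc l)
      ≡⟨ ≡.cong (ℕ→ℚ (suc l) *_) (⊛-antidiagonal f g i j (suc l)) ⟩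
    ℕ→ℚ (suc l) * convolve φ i j (suc l)
      ≡⟨ ≡.trans (antidiagonal-* i (ℕ→ℚ (suc l)) _)
           (antidiagonal-cong i λ a a′ → antidiagonal-* j (ℕ→ℚ (suc l)) _) ⟩
    _ ≡⟨ antidiagonal-cong i (λ a a′ → ≡.trans
           (antidiagonal-cong j λ b b′ → ≡.trans
             (antidiagonal-leibniz l (λ c c′ → φ a b c a′ b′ c′))
             (≡.cong₂ _+_
               (antidiagonal-cong l λ c c′ →
                 assoc (ℕ→ℚ (suc c)) (f a b (suc c)) (g a′ b′ c′))
               (antidiagonal-cong l λ c c′ →
                 x∙yz≈y∙xz (ℕ→ℚ (suc c′)) (f a b c) (g a′ b′ (suc c′)))))
           (antidiagonal-+ j _ _)) ⟩
    _ ≡⟨ antidiagonal-+ i _ _ ⟩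
    convolve (λ a b c a′ b′ c′ → dz f a b c * g a′ b′ c′) i j l +
    convolve (λ a b c a′ b′ c′ → f a b c * dz g a′ b′ c′) i j l
      ≡⟨ ≡.sym (≡.cong₂ _+_ (⊛-antidiagonal (dz f) g i j l) (⊛-antidiagonal f (dz g) i j l)) ⟩
    (dz f ⊛ g) i j l + (f ⊛ dz g) i j l ∎

-- From ordinary to exponential coefficients.

inv!*! : ∀ n → inv! n * ℕ→ℚ (n !) ≡ 1ℚ
inv!*! n = 1/n*n (n !) {{n !≢0}}

weight coweight : PS3
weight i j l   = ℕ→ℚ (i !) * (ℕ→ℚ (j !) * ℕ→ℚ (l !))
coweight i j l = inv! i * (inv! j * inv! l)

coweight*weight : ∀ i j l → coweight i j l * weight i j l ≡ 1ℚ
coweight*weight i j l = begin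
  coweight i j l * weight i j l
    ≡⟨ solve 6 (λ x y z u v w → (x :* (y :* z)) :* (u :* (v :* w)) :=
         (x :* u) :* ((y :* v) :* (z :* w))) ≡.refl
         (inv! i) (inv! j) (inv! l) (ℕ→ℚ (i !)) (ℕ→ℚ (j !)) (ℕ→ℚ (l !)) ⟩
  (inv! i * ℕ→ℚ (i !)) * ((inv! j * ℕ→ℚ (j !)) * (inv! l * ℕ→ℚ (l !)))
    ≡⟨ ≡.cong₂ _*_ (inv!*! i) (≡.cong₂ _*_ (inv!*! j) (inv!*! l)) ⟩
  1ℚ ∎
  where open ≡.≡-Reasoning

-- This scaling turns `dx`, `dy`, `dz` into index shifts, and hence `⊛` into the product of `T`.
egf : PS3 → PS3
egf f i j l = f i j l * weight i j l

egf-coweight : ∀ i j l x → x * coweight i j l * weight i j l ≡ x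
egf-coweight i j l x = ≡.trans (ℚ-Ring.*-assoc x (coweight i j l) (weight i j l))
  (≡.trans (≡.cong (x *_) (coweight*weight i j l)) (ℚ-Ring.*-identityʳ x))

egf-injective : ∀ f g i j l → egf f i j l ≡ egf g i j l → f i j l ≡ g i j l
egf-injective f g i j l e = begin
  f i j l                                    ≡⟨ ≡.sym (swap (f i j l)) ⟩
  f i j l * weight i j l * coweight i j l    ≡⟨ ≡.cong (_* coweight i j l) e ⟩
  g i j l * weight i j l * coweight i j l    ≡⟨ swap (g i j l) ⟩
  g i j l                                    ∎
  where
  open ≡.≡-Reasoning
  swap : ∀ x → x * weight i j l * coweight i j l ≡ x
  swap x = ≡.trans (CommutativeSemigroupProperties.xy∙z≈xz∙y ℚ-Ring.*-commutativeSemigroup x _ _)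
    (egf-coweight i j l x)

private
  !-suc : ∀ n → ℕ→ℚ (suc n !) ≡ ℕ→ℚ (suc n) * ℕ→ℚ (n !)
  !-suc n = ℕ→ℚ-* (suc n) (n !)

egf-dx : ∀ f i j l → egf (dx f) i j l ≡ egf f (suc i) j l
egf-dx f i j l = ≡.trans
  (solve 5 (λ s x u v w → s :* x :* (u :* (v :* w)) := x :* (s :* u :* (v :* w))) ≡.refl
    (ℕ→ℚ (suc i)) (f (suc i) j l) (ℕ→ℚ (i !)) (ℕ→ℚ (j !)) (ℕ→ℚ (l !)))
  (≡.cong (λ t → f (suc i) j l * (t * (ℕ→ℚ (j !) * ℕ→ℚ (l !)))) (≡.sym (!-suc i)))

egf-dy : ∀ f i j l → egf (dy f) i j l ≡ egf f i (suc j) l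
egf-dy f i j l = ≡.trans
  (solve 5 (λ s x u v w → s :* x :* (u :* (v :* w)) := x :* (u :* (s :* v :* w))) ≡.refl
    (ℕ→ℚ (suc j)) (f i (suc j) l) (ℕ→ℚ (i !)) (ℕ→ℚ (j !)) (ℕ→ℚ (l !)))
  (≡.cong (λ t → f i (suc j) l * (ℕ→ℚ (i !) * (t * ℕ→ℚ (l !)))) (≡.sym (!-suc j)))

egf-dz : ∀ f i j l → egf (dz f) i j l ≡ egf f i j (suc l)
egf-dz f i j l = ≡.trans
  (solve 5 (λ s x u v w → s :* x :* (u :* (v :* w)) := x :* (u :* (v :* (s :* w)))) ≡.refl
    (ℕ→ℚ (suc l)) (f i j (suc l)) (ℕ→ℚ (i !)) (ℕ→ℚ (j !)) (ℕ→ℚ (l !)))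
  (≡.cong (λ t → f i j (suc l) * (ℕ→ℚ (i !) * (ℕ→ℚ (j !) * t))) (≡.sym (!-suc l)))

egf-⊕ : ∀ f g i j l → egf (f ⊕ g) i j l ≡ egf f i j l + egf g i j l
egf-⊕ f g i j l = ℚ-Ring.distribʳ (weight i j l) (f i j l) (g i j l)

module _ (f g : PS3) (i j l : ℕ) where
  private
    leibniz : ∀ {h h₁ h₂ : PS3} → h i j l ≡ h₁ i j l + h₂ i j l →
      egf h i j l ≡ egf h₁ i j l + egf h₂ i j l
    leibniz {h} {h₁} {h₂} e = ≡.trans (≡.cong (_* weight i j l) e) (egf-⊕ h₁ h₂ i j l)

  egf-leibniz-x : egf (f ⊛ g) (suc i) j l ≡ egf (dx f ⊛ g) i j l + egf (f ⊛ dx g) i j l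
  egf-leibniz-x = ≡.trans (≡.sym (egf-dx (f ⊛ g) i j l))
    (leibniz {dx (f ⊛ g)} {dx f ⊛ g} {f ⊛ dx g} (leibniz-x f g i j l))

  egf-leibniz-y : egf (f ⊛ g) i (suc j) l ≡ egf (dy f ⊛ g) i j l + egf (f ⊛ dy g) i j l
  egf-leibniz-y = ≡.trans (≡.sym (egf-dy (f ⊛ g) i j l))
    (leibniz {dy (f ⊛ g)} {dy f ⊛ g} {f ⊛ dy g} (leibniz-y f g i j l))

  egf-leibniz-z : egf (f ⊛ g) i j (suc l) ≡ egf (dz f ⊛ g) i j l + egf (f ⊛ dz g) i j l
  egf-leibniz-z = ≡.trans (≡.sym (egf-dz (f ⊛ g) i j l))
    (leibniz {dz (f ⊛ g)} {dz f ⊛ g} {f ⊛ dz g} (leibniz-z f g i j l))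

open TripleSeries +-*-commutativeRing
  using (T; ι; cosx; sinx; cosz; sinz; cosyz; cosxyz; sinxyz)
open Trigonometric +-*-commutativeRing using (cosE; sinE)
module T = CommutativeRing T

-- A product is determined by its constant term and the three Leibniz rules.
module Multiplicative
  (e d₁ d₂ d₃ : PS3 → PS3)
  (shift₁ : ∀ f i j l → e (d₁ f) i j l ≡ e f (suc i) j l)
  (shift₂ : ∀ f i j l → e (d₂ f) i j l ≡ e f i (suc j) l)
  (shift₃ : ∀ f i j l → e (d₃ f) i j l ≡ e f i j (suc l))
  (leibniz₁ : ∀ f g i j l → e (f ⊛ g) (suc i) j l ≡ e (d₁ f ⊛ g) i j l + e (f ⊛ d₁ g) i j l)
  (leibniz₂ : ∀ f g i j l → e (f ⊛ g) i (suc j) l ≡ e (d₂ f ⊛ g) i j l + e (f ⊛ d₂ g) i j l)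
  (leibniz₃ : ∀ f g i j l → e (f ⊛ g) i j (suc l) ≡ e (d₃ f ⊛ g) i j l + e (f ⊛ d₃ g) i j l)
  (constant : ∀ f g → e (f ⊛ g) 0 0 0 ≡ e f 0 0 0 * e g 0 0 0)
  where

  ⊛-* : ∀ f g i j l → e (f ⊛ g) i j l ≡ (e f T.* e g) i j l
  ⊛-* f g zero zero zero = constant f g
  ⊛-* f g zero zero (suc l) = ≡.trans (leibniz₃ f g 0 0 l) (≡.cong₂ _+_
    (≡.trans (⊛-* (d₃ f) g 0 0 l)
      (T.*-cong {e (d₃ f)} {λ i j l → e f i j (suc l)} {e g} {e g} (shift₃ f) (λ _ _ _ → ≡.refl)
        0 0 l))
    (≡.trans (⊛-* f (d₃ g) 0 0 l)
      (T.*-cong {e f} {e f} {e (d₃ g)} {λ i j l → e g i j (suc l)} (λ _ _ _ → ≡.refl)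
        (shift₃ g) 0 0 l)))
  ⊛-* f g zero (suc j) l = ≡.trans (leibniz₂ f g 0 j l) (≡.cong₂ _+_
    (≡.trans (⊛-* (d₂ f) g 0 j l)
      (T.*-cong {e (d₂ f)} {λ i j l → e f i (suc j) l} {e g} {e g} (shift₂ f) (λ _ _ _ → ≡.refl)
        0 j l))
    (≡.trans (⊛-* f (d₂ g) 0 j l)
      (T.*-cong {e f} {e f} {e (d₂ g)} {λ i j l → e g i (suc j) l} (λ _ _ _ → ≡.refl)
        (shift₂ g) 0 j l)))
  ⊛-* f g (suc i) j l = ≡.trans (leibniz₁ f g i j l) (≡.cong₂ _+_
    (≡.trans (⊛-* (d₁ f) g i j l)
      (T.*-cong {e (d₁ f)} {λ i j l → e f (suc i) j l} {e g} {e g} (shift₁ f) (λ _ _ _ → ≡.refl)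
        i j l))
    (≡.trans (⊛-* f (d₁ g) i j l)
      (T.*-cong {e f} {e f} {e (d₁ g)} {λ i j l → e g (suc i) j l} (λ _ _ _ → ≡.refl)
        (shift₁ g) i j l)))

  ⊛-*-cong : ∀ {f g u v} → e f T.≈ u → e g T.≈ v → e (f ⊛ g) T.≈ u T.* v
  ⊛-*-cong {f} {g} {u} {v} p q i j l =
    ≡.trans (⊛-* f g i j l) (T.*-cong {e f} {u} {e g} {v} p q i j l)

+-reverse : ∀ i j l → i ℕ.+ j ℕ.+ l ≡ l ℕ.+ j ℕ.+ i
+-reverse i j l = ≡.trans (ℕₚ.+-comm (i ℕ.+ j) l)
  (≡.trans (≡.cong (l ℕ.+_) (ℕₚ.+-comm i j)) (≡.sym (ℕₚ.+-assoc l j i)))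

private
  egf-constant : ∀ f g → egf (f ⊛ g) 0 0 0 ≡ egf f 0 0 0 * egf g 0 0 0
  egf-constant f g = ≡.trans (ℚ-Ring.*-identityʳ _)
    (≡.sym (≡.cong₂ _*_ (ℚ-Ring.*-identityʳ (f 0 0 0)) (ℚ-Ring.*-identityʳ (g 0 0 0))))

  -- The lower entries were indexed with the roles of x and z exchanged.
  egfʳ : PS3 → PS3
  egfʳ f i j l = egf f l j i

  module Direct = Multiplicative egf dx dy dz egf-dx egf-dy egf-dz
    egf-leibniz-x egf-leibniz-y egf-leibniz-z egf-constant

  module Reversed = Multiplicative egfʳ dz dy dx
    (λ f i j l → egf-dz f l j i) (λ f i j l → egf-dy f l j i) (λ f i j l → egf-dx f l j i)
    (λ f g i j l → egf-leibniz-z f g l j i) (λ f g i j l → egf-leibniz-y f g l j i)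
    (λ f g i j l → egf-leibniz-x f g l j i) egf-constant

-- `f` holds ordinary and `h` exponential coefficients of one function. Under the reversed scaling a
-- function of x becomes one of z, and a function of x + y one of y + z.
module Substitution {f : PS1} {h : ℕ → ℚ} (f*! : ∀ n → f n * ℕ→ℚ (n !) ≡ h n) where
  private
    ιx : ∀ h i j l → ι true false false h i j l ≡ inX h i j l
    ιx h zero    zero    zero    = ≡.refl
    ιx h zero    zero    (suc l) = ≡.refl
    ιx h zero    (suc j) l       = ≡.refl
    ιx h (suc i) j       l       = ιx (λ n → h (suc n)) i j l

    ιz : ∀ h i j l → ι false false true h i j l ≡ inZ h i j l
    ιz h zero    zero    zero    = ≡.refl
    ιz h zero    zero    (suc l) = ιz (λ n → h (suc n)) 0 0 l
    ιz h zero    (suc j) l       = ≡.refl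
    ιz h (suc i) j       l       = ≡.refl

    ιxyz : ∀ h i j l → ι true true true h i j l ≡ h (i ℕ.+ j ℕ.+ l)
    ιxyz h zero    zero    zero    = ≡.refl
    ιxyz h zero    zero    (suc l) = ιxyz (λ n → h (suc n)) 0 0 l
    ιxyz h zero    (suc j) l       = ιxyz (λ n → h (suc n)) 0 j l
    ιxyz h (suc i) j       l       = ιxyz (λ n → h (suc n)) i j l

    ιyz : ∀ h j l → ι false true true h 0 j l ≡ h (j ℕ.+ l)
    ιyz h zero    zero    = ≡.refl
    ιyz h zero    (suc l) = ιyz (λ n → h (suc n)) 0 l
    ιyz h (suc j) l       = ιyz (λ n → h (suc n)) j l

    egf-inX′ : ∀ i j l → egf (inX f) i j l ≡ inX h i j l
    egf-inX′ i zero    zero    =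
      ≡.trans (≡.cong (f i *_) (ℚ-Ring.*-identityʳ (ℕ→ℚ (i !)))) (f*! i)
    egf-inX′ i zero    (suc l) = ℚ-Ring.zeroˡ (weight i 0 (suc l))
    egf-inX′ i (suc j) l       = ℚ-Ring.zeroˡ (weight i (suc j) l)

    egf-inZ′ : ∀ i j l → egf (inZ f) i j l ≡ inZ h i j l
    egf-inZ′ zero    zero    l = ≡.trans
      (≡.cong (f l *_) (≡.trans (ℚ-Ring.*-identityˡ _) (ℚ-Ring.*-identityˡ (ℕ→ℚ (l !))))) (f*! l)
    egf-inZ′ zero    (suc j) l = ℚ-Ring.zeroˡ (weight 0 (suc j) l)
    egf-inZ′ (suc i) j       l = ℚ-Ring.zeroˡ (weight (suc i) j l)

    inX-inZ : ∀ h i j l → inX h l j i ≡ inZ h i j l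
    inX-inZ h zero    zero    l = ≡.refl
    inX-inZ h (suc i) zero    l = ≡.refl
    inX-inZ h zero    (suc j) l = ≡.refl
    inX-inZ h (suc i) (suc j) l = ≡.refl

    egf-inXYZ′ : ∀ i j l → egf (inXYZ f) i j l ≡ h (i ℕ.+ j ℕ.+ l)
    egf-inXYZ′ i j l = ≡.trans
      (≡.cong (_* weight i j l) (≡.sym (ℚ-Ring.*-assoc (f n) (ℕ→ℚ (n !)) (coweight i j l))))
      (≡.trans (egf-coweight i j l _) (f*! n))
      where n = i ℕ.+ j ℕ.+ l

  egf-inX : egf (inX f) T.≈ ι true false false h
  egf-inX i j l = ≡.trans (egf-inX′ i j l) (≡.sym (ιx h i j l))

  egf-inZ : egf (inZ f) T.≈ ι false false true h
  egf-inZ i j l = ≡.trans (egf-inZ′ i j l) (≡.sym (ιz h i j l))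

  egf-inXYZ : egf (inXYZ f) T.≈ ι true true true h
  egf-inXYZ i j l = ≡.trans (egf-inXYZ′ i j l) (≡.sym (ιxyz h i j l))

  egfʳ-inX : egfʳ (inX f) T.≈ ι false false true h
  egfʳ-inX i j l = ≡.trans (egf-inX′ l j i) (≡.trans (inX-inZ h i j l) (≡.sym (ιz h i j l)))

  egfʳ-inZ : egfʳ (inZ f) T.≈ ι true false false h
  egfʳ-inZ i j l = ≡.trans (egf-inZ′ l j i) (≡.trans (≡.sym (inX-inZ h l j i)) (≡.sym (ιx h i j l)))

  egfʳ-inXYZ : egfʳ (inXYZ f) T.≈ ι true true true h
  egfʳ-inXYZ i j l = ≡.trans (egf-inXYZ′ l j i)
    (≡.trans (≡.cong h (+-reverse l j i)) (≡.sym (ιxyz h i j l)))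

  egfʳ-inXY : egfʳ (inXY f) T.≈ ι false true true h
  egfʳ-inXY (suc i) j l = ℚ-Ring.zeroˡ (weight l j (suc i))
  egfʳ-inXY zero    j l = begin
    f n * (ℕ→ℚ (n !) * (inv! l * inv! j)) * weight l j 0
      -- The missing factor `inv! 0` is 1; with it the product becomes a full `coweight`.
      ≡⟨ ≡.cong (λ t → f n * (ℕ→ℚ (n !) * (inv! l * t)) * weight l j 0)
           (≡.sym (ℚ-Ring.*-identityʳ (inv! j))) ⟩
    f n * (ℕ→ℚ (n !) * coweight l j 0) * weight l j 0
      ≡⟨ ≡.cong (_* weight l j 0) (≡.sym (ℚ-Ring.*-assoc (f n) (ℕ→ℚ (n !)) (coweight l j 0))) ⟩
    f n * ℕ→ℚ (n !) * coweight l j 0 * weight l j 0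
      ≡⟨ egf-coweight l j 0 _ ⟩
    f n * ℕ→ℚ (n !)
      ≡⟨ f*! n ⟩
    h n
      ≡⟨ ≡.cong h (ℕₚ.+-comm l j) ⟩
    h (j ℕ.+ l)
      ≡⟨ ≡.sym (ιyz h j l) ⟩
    ι false true true h 0 j l ∎
    where
    open ≡.≡-Reasoning
    n = l ℕ.+ j

cosE-sgn : ∀ n → cosE n ≡ (if even n then sgn (half n) else 0ℚ)
cosE-sgn zero          = ≡.refl
cosE-sgn (suc zero)    = ≡.refl
cosE-sgn (suc (suc n)) with even n | cosE-sgn n
... | true  | e = ≡.cong -_ e
... | false | e = ≡.cong -_ e

sinE-sgn : ∀ n → sinE n ≡ (if even n then 0ℚ else sgn (half n))
sinE-sgn zero          = ≡.refl
sinE-sgn (suc zero)    = ≡.refl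
sinE-sgn (suc (suc n)) with even n | sinE-sgn n
... | true  | e = ≡.cong -_ e
... | false | e = ≡.cong -_ e

private
  cancel-inv! : ∀ n x → x * inv! n * ℕ→ℚ (n !) ≡ x
  cancel-inv! n x = ≡.trans (ℚ-Ring.*-assoc x (inv! n) (ℕ→ℚ (n !)))
    (≡.trans (≡.cong (x *_) (inv!*! n)) (ℚ-Ring.*-identityʳ x))

cosS*! : ∀ n → cosS n * ℕ→ℚ (n !) ≡ cosE n
cosS*! n with even n | cosE-sgn n
... | true  | e = ≡.trans (cancel-inv! n (sgn (half n))) (≡.sym e)
... | false | e = ≡.trans (ℚ-Ring.zeroˡ (ℕ→ℚ (n !))) (≡.sym e)

sinS*! : ∀ n → sinS n * ℕ→ℚ (n !) ≡ sinE n
sinS*! n with even n | sinE-sgn n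
... | true  | e = ≡.trans (ℚ-Ring.zeroˡ (ℕ→ℚ (n !))) (≡.sym e)
... | false | e = ≡.trans (cancel-inv! n (sgn (half n))) (≡.sym e)

-- Comparison of the generating functions with the closed forms.

module _ {a b : Fam} (twin : IsTwinSeidel a b) where
  private
    module A = TwinSeidel twin
    module C = ClosedForm +-*-commutativeRing
    module Cos = Substitution {cosS} cosS*!
    module Sin = Substitution {sinS} sinS*!

  egf-genUpper : egf (genUpper a) T.≈ C.AU
  egf-genUpper i j l = ≡.trans entries
    (upper-unique +-*-commutativeRing A.isTwinSolution C.isTwinSolution i j l)
    where
    entries : egf (genUpper a) i j l ≡ A.AU i j l
    entries rewrite ℕₚ.+-comm (i ℕ.+ j ℕ.+ l) 3 | ℕₚ.+-comm i 1 | ℕₚ.+-comm (i ℕ.+ j) 2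
      with even (3 ℕ.+ (i ℕ.+ j ℕ.+ l))
    ... | true  = egf-coweight i j l _
    ... | false = ℚ-Ring.zeroˡ (weight i j l)

  egfʳ-genLower : egfʳ (genLower a) T.≈ C.AL
  egfʳ-genLower i j l = ≡.trans entries
    (lower-unique +-*-commutativeRing A.isTwinSolution C.isTwinSolution i j l)
    where
    entries : egf (genLower a) l j i ≡ A.AL i j l
    entries rewrite +-reverse l j i
      | ℕₚ.+-comm (i ℕ.+ j ℕ.+ l) 3 | ℕₚ.+-comm i 1 | ℕₚ.+-comm (i ℕ.+ j) 2
      with even (3 ℕ.+ (i ℕ.+ j ℕ.+ l))
    ... | true  = egf-coweight l j i _
    ... | false = ℚ-Ring.zeroˡ (weight l j i)

  upper : ∀ i j l → (genUpper a ⊛ inXYZ cosS ⊛ inXYZ cosS) i j l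
                      ≡ (inX cosS ⊛ inZ cosS ⊛ inXYZ sinS) i j l
  upper i j l = egf-injective (genUpper a ⊛ inXYZ cosS ⊛ inXYZ cosS)
    (inX cosS ⊛ inZ cosS ⊛ inXYZ sinS) i j l (begin
      egf (genUpper a ⊛ inXYZ cosS ⊛ inXYZ cosS) i j l
        ≡⟨ *-cong {genUpper a ⊛ inXYZ cosS} {inXYZ cosS} {C.AU T.* cosxyz} {cosxyz}
             (*-cong {genUpper a} {inXYZ cosS} {C.AU} {cosxyz} egf-genUpper Cos.egf-inXYZ)
             Cos.egf-inXYZ i j l ⟩
      (C.AU T.* cosxyz T.* cosxyz) i j l
        ≡⟨ C.AU*cos² i j l ⟩
      (cosx T.* cosz T.* sinxyz) i j l
        ≡⟨ ≡.sym (*-cong {inX cosS ⊛ inZ cosS} {inXYZ sinS} {cosx T.* cosz} {sinxyz}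
             (*-cong {inX cosS} {inZ cosS} {cosx} {cosz} Cos.egf-inX Cos.egf-inZ)
             Sin.egf-inXYZ i j l) ⟩
      egf (inX cosS ⊛ inZ cosS ⊛ inXYZ sinS) i j l ∎)
    where
    open Direct renaming (⊛-*-cong to *-cong)
    open ≡.≡-Reasoning

  -- All identities in `T` are read at `l j i`, which undoes the exchange of x and z; this is how
  -- cos(y+z) in the closed form becomes cos(x+y).
  lower : ∀ i j l → (genLower a ⊛ inXYZ cosS ⊛ inXYZ cosS) i j l
    ≡ (inX cosS ⊛ inZ sinS ⊛ inXYZ cosS ⊕ inX sinS ⊛ inXY cosS) i j l
  lower i j l = egf-injective (genLower a ⊛ inXYZ cosS ⊛ inXYZ cosS)
    (inX cosS ⊛ inZ sinS ⊛ inXYZ cosS ⊕ inX sinS ⊛ inXY cosS) i j l (begin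
      egf (genLower a ⊛ inXYZ cosS ⊛ inXYZ cosS) i j l
        ≡⟨ *-cong {genLower a ⊛ inXYZ cosS} {inXYZ cosS} {C.AL T.* cosxyz} {cosxyz}
             (*-cong {genLower a} {inXYZ cosS} {C.AL} {cosxyz} egfʳ-genLower Cos.egfʳ-inXYZ)
             Cos.egfʳ-inXYZ l j i ⟩
      (C.AL T.* cosxyz T.* cosxyz) l j i
        ≡⟨ C.AL*cos² l j i ⟩
      (cosz T.* sinx T.* cosxyz) l j i + (sinz T.* cosyz) l j i
        ≡⟨ ≡.sym (≡.cong₂ _+_
             (*-cong {inX cosS ⊛ inZ sinS} {inXYZ cosS} {cosz T.* sinx} {cosxyz}
               (*-cong {inX cosS} {inZ sinS} {cosz} {sinx} Cos.egfʳ-inX Sin.egfʳ-inZ)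
               Cos.egfʳ-inXYZ l j i)
             (*-cong {inX sinS} {inXY cosS} {sinz} {cosyz} Sin.egfʳ-inX Cos.egfʳ-inXY l j i)) ⟩
      egf (inX cosS ⊛ inZ sinS ⊛ inXYZ cosS) i j l + egf (inX sinS ⊛ inXY cosS) i j l
        ≡⟨ ≡.sym (egf-⊕ (inX cosS ⊛ inZ sinS ⊛ inXYZ cosS) (inX sinS ⊛ inXY cosS) i j l) ⟩
      egf (inX cosS ⊛ inZ sinS ⊛ inXYZ cosS ⊕ inX sinS ⊛ inXY cosS) i j l ∎)
    where
    open Reversed renaming (⊛-*-cong to *-cong)
    open ≡.≡-Reasoning

theorem1p3 : (a b : Fam) → IsTwinSeidel a b →
    (∀ i j l →
    (genUpper a ⊛ inXYZ cosS ⊛ inXYZ cosS) i j l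
    ≡ (inX cosS ⊛ inZ cosS ⊛ inXYZ sinS) i j l)
    × (∀ i j l →
    (genLower a ⊛ inXYZ cosS ⊛ inXYZ cosS) i j l
    ≡ (inX cosS ⊛ inZ sinS ⊛ inXYZ cosS ⊕ inX sinS ⊛ inXY cosS) i j l)
theorem1p3 a b twin = upper twin , lower twin
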